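{- Let $\sigma$ be a term ordering, let $F$ be a formula in 2-XNF, and let $G$ be an implication graph structure for $F$. Then the procedure $\mathrm{crGGCP}$ (described in the context) is an algorithm, i.e. it terminates after finitely many steps, which returns a tuple $G'=\mathrm{crGGCP}_\sigma(G)$ with the following properties: (a) The tuple $G'=(L',V',E')$ is a $\sigma$-reduced implication graph structure for $F$. (b) We have $G'\preceq G$. (c) The directed graph $(V',E')$ is acyclic.
   Context: $\mathbb{B}_n=\mathbb{F}_2[X_1,\dots,X_n]/\langle X_1^2-X_1,\dots,X_n^2-X_n\rangle$ is the ring of Boolean polynomials, $x_i$ the residue class of $X_i$, and $\mathbb{L}_n=\langle 1,x_1,\dots,x_n\rangle_{\mathbb{F}_2}$ the space of linear Boolean polynomials. $\mathrm{Supp}(f)$ is the set of square-free terms occurring in $f$. A term ordering $\sigma$ on $\mathbb{F}_2[X_1,\dots,X_n]$ induces an ordering on the square-free terms of $\mathbb{B}_n$, and $\mathrm{LT}_\sigma(f)$ is the largest term in $\mathrm{Supp}(f)$; $\mathrm{LT}_\sigma(L)$ is the set of leading terms of the elements of $L$. $\mathrm{NR}_\sigma(f,L)$ is the normal remainder of $f$ under the division algorithm by the elements of $L$ with respect to $\sigma$ (performed on the canonical square-free representatives). A lineral is an XOR of literals; a formula is in 2-XNF if it is a conjunction of clauses each of which is a disjunction of at most two linerals. For such a formula $F$ in the variables $X_1,\dots,X_n$ (true $=1$, false $=0$), $I_F\subseteq\mathbb{B}_n$ is the unique ideal whose zero set in $\mathbb{F}_2^n$ equals the set of satisfying assignments of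 $F$. An implication graph structure (IGS) for $F$ is a tuple $(L,V,E)$ with $L,V\subseteq\mathbb{L}_n$ and $E\subseteq V^2$ such that (1) $I_F=\langle L\rangle+\langle fg\mid (f+1,g)\in E\rangle$; (2) for all $(f+1,g)\in E$ we have $(g+1,f)\in E$; (3) for all $f\in V$, $(f,f)\notin E$. It is $\sigma$-reduced if the polynomials in $L$ have pairwise distinct leading terms and $\mathrm{LT}_\sigma(L)\cap\bigcup_{f\in V}\mathrm{Supp}(f)=\emptyset$. For two IGSs $G'=(L',V',E')$ and $G=(L,V,E)$ for $F$, $G'\preceq G$ means $\langle L'\rangle_{\mathbb{F}_2}\supseteq\langle L\rangle_{\mathbb{F}_2}$ and $\#V'\le\#V$. A strongly connected component of a directed graph $(V,E)$ is a subset $S\subseteq V$ such that for all $f,g\in S$ there is a path from $f$ to $g$, and which is maximal with this property. Procedure $\mathrm{GGCP}$, with input an IGS $G$ for $F$ and a term ordering $\sigma$: Line 1: Write $G=(L,V,E)$ and $\mathrm{LT}_\sigma$-interreduce $L$ (i.e. pass to a generating set of the same $\mathbb{F}_2$-span whose elements have pairwise distinct leading terms). Line 2: Let $(L',V',E')=(L,\emptyset,\emptyset)$. Lines 3-8: For each $(f,g)\in E$: let $f'=\mathrm{NR}_\sigma(f,L)$ and $g'=\mathrm{NR}_\sigma(g,L)$; if $f'=0$ and $g'\ne0$, append $g'$ to $L'$; if $g'=1$ and $f'\neq1$, append $f'+1$ to $L'$; if $f'\notin\mathbb{F}_2$ and $g'\notin\mathbb{F}_2$ and $f'\ne g'$,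 append $(f',g')$ to $E'$ and append $f'$ and $g'$ to $V'$. Line 9: If $L\ne L'$, set $(L,V,E)=(L',V',E')$ and go to Line 2. Line 10: Otherwise return $(L',V',E')$. Procedure $\mathrm{crGGCP}$, with input an IGS $G$ for $F$ and a term ordering $\sigma$: Line 1: Compute $(L',V',E')=\mathrm{GGCP}_\sigma(G)$ and let $L_{SCC}=\emptyset$. Line 2: Compute the set $\mathcal{C}$ of all strongly connected components of $(V',E')$. Line 3: If $\#\mathcal{C}$ is odd, return $(\mathbb{L}_n,\emptyset,\emptyset)$. Lines 4-5: For each $S\in\mathcal{C}$ write $S=\{f_1,\dots,f_r\}$ and, for all $i\in\{2,\dots,r\}$, append $f_1+f_i$ to $L_{SCC}$. Line 6: If $L_{SCC}\neq\emptyset$, set $G=(L'\cup L_{SCC},V',E')$ and go to Line 1. Line 7: Otherwise return $(L',V',E')$.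
   Formalization: Line 9 of GGCP jumps to the interreduction of Line 1 instead of Line 2; if #C is odd, crGGCP returns the generators 1,x_1,…,x_n instead of all of 𝕃_n; strongly connected components are nonempty. As printed, property (a) fails in these places. -}

module Defs where

open import Level using (0ℓ)
open import Algebra.Bundles using (CommutativeRing)
import Algebra.Properties.Monoid.Sum as MonoidSum
open import Data.Bool using (Bool; true; false; not; if_then_else_; _∧_; _xor_)
import Data.Bool.Properties as Bool
open import Data.Fin using (Fin; zero; suc)
open import Data.List using (List; []; _∷_; _++_; map; foldr; concatMap; length; deduplicate; and; or; tabulate)
open import Data.List.Membership.Propositional using (_∈_)
open import Data.List.Relation.Binary.BagAndSetEquality using (_∼[_]_; set)
open import Data.List.Relation.Binary.Subset.Propositional using (_⊆_)
open import Data.List.Relation.Unary.All using (All)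
open import Data.List.Relation.Unary.AllPairs using (AllPairs)
open import Data.List.Relation.Unary.Any using (Any)
open import Data.List.Relation.Unary.Unique.Propositional using (Unique)
open import Data.Nat using (ℕ; zero; suc) renaming (_+_ to _+ℕ_; _≤_ to _≤ℕ_)
open import Data.Nat.Divisibility using (_∣_)
open import Data.Product using (_×_; _,_; ∃-syntax; Σ-syntax; proj₁; proj₂)
open import Data.Sum using (_⊎_)
open import Data.Vec using (Vec; _∷_; lookup; zipWith; replicate; _[_]≔_)
open import Data.Vec.Bounded using (Vec≤; toList)
open import Data.Vec.Properties using (≡-dec)
open import Function.Bundles using (_⇔_)
open import Relation.Binary using (Rel; DecidableEquality; IsTotalOrder)
open import Relation.Binary.Construct.Closure.ReflexiveTransitive using (Star)
open import Relation.Binary.Construct.Closure.Transitive using (TransClosure)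
open import Relation.Binary.PropositionalEquality using (_≡_; _≢_)
open import Relation.Nullary using (¬_; Dec; does; ¬?; _×-dec_)
open import Relation.Unary using (Pred; _≐_) renaming (_⊆_ to _⊆ᵖ_)

-- 𝔽₂[X₁,…,Xₙ]/⟨X₁²-X₁,…,Xₙ²-Xₙ⟩ as a setoid: polynomial expressions modulo
-- the least congruence _≈_ that contains the commutative ring laws, 1 + 1 = 0
-- (in the form f + f = 0) and the relations xᵢ² = xᵢ.

infixl 6 _⊕_
infixl 7 _⊗_
infix  4 _≈_

data 𝔹 (n : ℕ) : Set where
  0ᵇ 1ᵇ   : 𝔹 n
  x       : Fin n → 𝔹 n
  _⊕_ _⊗_ : 𝔹 n → 𝔹 n → 𝔹 n

data _≈_ {n : ℕ} : Rel (𝔹 n) 0ℓ where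
  ≈-refl      : ∀ {f} → f ≈ f
  ≈-sym       : ∀ {f g} → f ≈ g → g ≈ f
  ≈-trans     : ∀ {f g h} → f ≈ g → g ≈ h → f ≈ h
  ⊕-cong      : ∀ {f f′ g g′} → f ≈ f′ → g ≈ g′ → f ⊕ g ≈ f′ ⊕ g′
  ⊕-assoc     : ∀ f g h → (f ⊕ g) ⊕ h ≈ f ⊕ (g ⊕ h)
  ⊕-comm      : ∀ f g → f ⊕ g ≈ g ⊕ f
  ⊕-identityˡ : ∀ f → 0ᵇ ⊕ f ≈ f
  ⊕-self      : ∀ f → f ⊕ f ≈ 0ᵇ
  ⊗-cong      : ∀ {f f′ g g′} → f ≈ f′ → g ≈ g′ → f ⊗ g ≈ f′ ⊗ g′
  ⊗-assoc     : ∀ f g h → (f ⊗ g) ⊗ h ≈ f ⊗ (g ⊗ h)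
  ⊗-comm      : ∀ f g → f ⊗ g ≈ g ⊗ f
  ⊗-identityˡ : ∀ f → 1ᵇ ⊗ f ≈ f
  ⊗-distribˡ  : ∀ f g h → f ⊗ (g ⊕ h) ≈ (f ⊗ g) ⊕ (f ⊗ h)
  x-idem      : ∀ i → x i ⊗ x i ≈ x i

𝔹-ring : ℕ → CommutativeRing 0ℓ 0ℓ
𝔹-ring n = record
  { Carrier = 𝔹 n
  ; _≈_     = _≈_
  ; _+_     = _⊕_
  ; _*_     = _⊗_
  ; -_      = λ f → f
  ; 0#      = 0ᵇ
  ; 1#      = 1ᵇ
  ; isCommutativeRing = record
    { isRing = record
      { +-isAbelianGroup = record
        { isGroup = record
          { isMonoid = record
            { isSemigroup = record
              { isMagma = record
                { isEquivalence = record
                  { refl = ≈-refl ; sym = ≈-sym ; trans = ≈-trans }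
                ; ∙-cong = ⊕-cong
                }
              ; assoc = ⊕-assoc
              }
            ; identity = ⊕-identityˡ
                       , λ f → ≈-trans (⊕-comm f 0ᵇ) (⊕-identityˡ f)
            }
          ; inverse = ⊕-self , ⊕-self
          ; ⁻¹-cong = λ p → p
          }
        ; comm = ⊕-comm
        }
      ; *-cong     = ⊗-cong
      ; *-assoc    = ⊗-assoc
      ; *-identity = ⊗-identityˡ
                   , λ f → ≈-trans (⊗-comm f 1ᵇ) (⊗-identityˡ f)
      ; distrib    = ⊗-distribˡ
                   , λ f g h → ≈-trans (⊗-comm (g ⊕ h) f)
                       (≈-trans (⊗-distribˡ f g h)
                                (⊕-cong (⊗-comm f g) (⊗-comm f h)))
      }
    ; *-comm = ⊗-comm
    }
  }

Assignment : ℕ → Set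
Assignment n = Fin n → Bool

eval : ∀ {n} → Assignment n → 𝔹 n → Bool
eval a 0ᵇ      = false
eval a 1ᵇ      = true
eval a (x i)   = a i
eval a (f ⊕ g) = eval a f xor eval a g
eval a (f ⊗ g) = eval a f ∧ eval a g

record IsIdeal {n : ℕ} (I : Pred (𝔹 n) 0ℓ) : Set where
  field
    resp     : ∀ {f g} → f ≈ g → I f → I g
    0∈       : I 0ᵇ
    ⊕-closed : ∀ {f g} → I f → I g → I (f ⊕ g)
    ⊗-closed : ∀ f {g} → I g → I (f ⊗ g)

data ⟨_⟩ {n : ℕ} (S : Pred (𝔹 n) 0ℓ) : Pred (𝔹 n) 0ℓ where
  gen      : ∀ {f} → S f → ⟨ S ⟩ f
  resp     : ∀ {f g} → f ≈ g → ⟨ S ⟩ f → ⟨ S ⟩ g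
  0∈       : ⟨ S ⟩ 0ᵇ
  ⊕-closed : ∀ {f g} → ⟨ S ⟩ f → ⟨ S ⟩ g → ⟨ S ⟩ (f ⊕ g)
  ⊗-closed : ∀ f {g} → ⟨ S ⟩ g → ⟨ S ⟩ (f ⊗ g)

_+ⁱ_ : ∀ {n} → Pred (𝔹 n) 0ℓ → Pred (𝔹 n) 0ℓ → Pred (𝔹 n) 0ℓ
(I +ⁱ J) f = ∃[ g ] ∃[ h ] (I g × J h × f ≈ g ⊕ h)

𝒵 : ∀ {n} → Pred (𝔹 n) 0ℓ → Pred (Assignment n) 0ℓ
𝒵 I a = ∀ f → I f → eval a f ≡ false

data Literal (n : ℕ) : Set where
  pos neg : Fin n → Literal n

Lineral Clause 2-XNF : ℕ → Set
Lineral n = List (Literal n)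
Clause  n = Vec≤ (Lineral n) 2
2-XNF   n = List (Clause n)

evalLiteral : ∀ {n} → Assignment n → Literal n → Bool
evalLiteral a (pos i) = a i
evalLiteral a (neg i) = not (a i)

evalLineral : ∀ {n} → Assignment n → Lineral n → Bool
evalLineral a ℓ = foldr _xor_ false (map (evalLiteral a) ℓ)

evalClause : ∀ {n} → Assignment n → Clause n → Bool
evalClause a C = or (map (evalLineral a) (toList C))

Sat : ∀ {n} → 2-XNF n → Pred (Assignment n) 0ℓ
Sat F a = and (map (evalClause a) F) ≡ true

IsIdealOf : ∀ {n} → 2-XNF n → Pred (𝔹 n) 0ℓ → Set
IsIdealOf F I = IsIdeal I × 𝒵 I ≐ Sat F

-- c ∷ (a₁ ∷ … ∷ aₙ ∷ []) stands for c + a₁x₁ + … + aₙxₙ; its image in 𝔹 n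
-- is given by ι below.

𝕃 : ℕ → Set
𝕃 n = Vec Bool (suc n)

infixl 6 _+ˡ_
_+ˡ_ : ∀ {n} → 𝕃 n → 𝕃 n → 𝕃 n
_+ˡ_ = zipWith _xor_

0ˡ 1ˡ : ∀ {n} → 𝕃 n
0ˡ = replicate _ false
1ˡ = true ∷ replicate _ false

infix 4 _≟_
_≟_ : ∀ {n} → DecidableEquality (𝕃 n)
_≟_ = ≡-dec Bool._≟_

basis : ∀ {n} → Fin (suc n) → 𝔹 n
basis zero    = 1ᵇ
basis (suc i) = x i

scalar : ∀ {n} → Bool → 𝔹 n
scalar c = if c then 1ᵇ else 0ᵇ

ι : ∀ {n} → 𝕃 n → 𝔹 n
ι {n} f = sum (λ i → scalar (lookup f i) ⊗ basis i)
  where open MonoidSum (CommutativeRing.+-monoid (𝔹-ring n)) using (sum)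

data Span {n : ℕ} (L : List (𝕃 n)) : Pred (𝕃 n) 0ℓ where
  0∈  : Span L 0ˡ
  add : ∀ {h f} → h ∈ L → Span L f → Span L (h +ˡ f)

𝕃-generators : ∀ n → List (𝕃 n)
𝕃-generators n = tabulate (λ i → 0ˡ [ i ]≔ true)

-- X₁^e₁ ⋯ Xₙ^eₙ is represented by its exponent vector.
Term : ℕ → Set
Term n = Vec ℕ n

infixl 7 _·_
_·_ : ∀ {n} → Term n → Term n → Term n
_·_ = zipWith _+ℕ_

1ᵗ : ∀ {n} → Term n
1ᵗ = replicate _ 0

record TermOrdering (n : ℕ) : Set₁ where
  field
    _≤_          : Rel (Term n) 0ℓ
    isTotalOrder : IsTotalOrder _≡_ _≤_
    1-minimum    : ∀ t → 1ᵗ ≤ t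
    ·-monoʳ      : ∀ u {s t} → s ≤ t → (u · s) ≤ (u · t)

term : ∀ {n} → Fin (suc n) → Term n
term zero    = 1ᵗ
term (suc i) = 1ᵗ [ i ]≔ 1

Supp : ∀ {n} → 𝕃 n → Pred (Term n) 0ℓ
Supp f t = ∃[ i ] (lookup f i ≡ true × term i ≡ t)

-- The zero polynomial has no leading term.
IsLT : ∀ {n} → TermOrdering n → 𝕃 n → Pred (Term n) 0ℓ
IsLT σ f t = Supp f t × (∀ s → Supp f s → s ≤ t)
  where open TermOrdering σ

DistinctLTs : ∀ {n} → TermOrdering n → List (𝕃 n) → Set
DistinctLTs σ L = (∀ {f} → f ∈ L → f ≢ 0ˡ)
                × (∀ {f g t} → f ∈ L → g ∈ L → IsLT σ f t → IsLT σ g t → f ≡ g)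

Interreduces : ∀ {n} → TermOrdering n → List (𝕃 n) → List (𝕃 n) → Set
Interreduces σ L L′ = Span L′ ≐ Span L × DistinctLTs σ L′

_·Supp_ : ∀ {n} → Term n → 𝕃 n → Pred (Term n) 0ℓ
(t ·Supp h) s = ∃[ u ] (Supp h u × s ≡ t · u)

-- A division step in 𝔽₂[X₁,…,Xₙ]: some h ∈ L and some term t with
-- t · LT(h) ∈ Supp(f) are chosen, and f is replaced by f′ = f - t h. Over 𝔽₂
-- this equation says that Supp(f′) is the symmetric difference of Supp(f) and
-- Supp(t h). No step leaves the linear polynomials: either t = 1, or LT(h) = 1
-- and then h = 1.
record _,_⊢_⟶_ {n : ℕ} (σ : TermOrdering n) (L : List (𝕃 n)) (f f′ : 𝕃 n) : Set where
  field
    {h}      : 𝕃 n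
    {t lt}   : Term n
    divisor  : h ∈ L
    leading  : IsLT σ h lt
    occurs   : Supp f (t · lt)
    subtract : ∀ s → Supp f′ s ⇔ ((Supp f s × ¬ (t ·Supp h) s) ⊎ (¬ Supp f s × (t ·Supp h) s))

Irreducible : ∀ {n} → TermOrdering n → List (𝕃 n) → 𝕃 n → Set
Irreducible σ L r = ∀ {h t lt} → h ∈ L → IsLT σ h lt → ¬ Supp r (t · lt)

-- "r is the result of dividing f by L". The choices made during the division
-- are left open; they do not influence r when the leading terms of the
-- elements of L are pairwise distinct.
NR : ∀ {n} → TermOrdering n → List (𝕃 n) → 𝕃 n → 𝕃 n → Set
NR σ L f r = Star (σ , L ⊢_⟶_) f r × Irreducible σ L r

-- Lists represent finite sets throughout: order and repetitions of entries
-- are irrelevant.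

Edge : ℕ → Set
Edge n = 𝕃 n × 𝕃 n

record Tuple (n : ℕ) : Set where
  constructor ⟪_,_,_⟫
  field
    L : List (𝕃 n)
    V : List (𝕃 n)
    E : List (Edge n)

-- The parameter I is meant to be the ideal I_F of the formula F, see IsIdealOf.
record IsIGS {n : ℕ} (I : Pred (𝔹 n) 0ℓ) (G : Tuple n) : Set where
  open Tuple G
  field
    edges⊆V²       : ∀ {f g} → (f , g) ∈ E → f ∈ V × g ∈ V
    ideal          : I ≐ ⟨ (λ p → Σ[ f ∈ 𝕃 n ] (f ∈ L × p ≈ ι f)) ⟩
                       +ⁱ ⟨ (λ p → Σ[ f ∈ 𝕃 n ] Σ[ g ∈ 𝕃 n ] ((f +ˡ 1ˡ , g) ∈ E × p ≈ ι f ⊗ ι g)) ⟩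
    skew-symmetric : ∀ {f g} → (f +ˡ 1ˡ , g) ∈ E → (g +ˡ 1ˡ , f) ∈ E
    irreflexive    : ∀ {f} → f ∈ V → ¬ (f , f) ∈ E

IsReduced : ∀ {n} → TermOrdering n → Tuple n → Set
IsReduced σ G = DistinctLTs σ L
              × (∀ {h f t} → h ∈ L → f ∈ V → IsLT σ h t → ¬ Supp f t)
  where open Tuple G

# : ∀ {n} → List (𝕃 n) → ℕ
# V = length (deduplicate _≟_ V)

infix 4 _⪯_
_⪯_ : ∀ {n} → Tuple n → Tuple n → Set
G′ ⪯ G = Span (L G) ⊆ᵖ Span (L G′) × # (V G′) ≤ℕ # (V G)
  where open Tuple

_∋_↦_ : ∀ {n} → List (Edge n) → Rel (𝕃 n) 0ℓ
E ∋ f ↦ g = (f , g) ∈ E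

IsAcyclic : ∀ {n} → Tuple n → Set
IsAcyclic G = ∀ f → ¬ TransClosure (Tuple.E G ∋_↦_) f f

record IsStronglyConnected {n : ℕ} (G : Tuple n) (S : List (𝕃 n)) : Set where
  open Tuple G
  field
    subset : S ⊆ V
    paths  : ∀ {f g} → f ∈ S → g ∈ S → Star (E ∋_↦_) f g

-- As usual, components are nonempty: otherwise the empty graph would have the
-- component ∅. Uniqueness makes S an enumeration f₁, …, f_r without repetition.
record IsSCC {n : ℕ} (G : Tuple n) (S : List (𝕃 n)) : Set where
  field
    unique    : Unique S
    nonempty  : S ≢ []
    connected : IsStronglyConnected G S
    maximal   : ∀ {T} → IsStronglyConnected G T → S ⊆ T → T ⊆ S

record AreAllSCCs {n : ℕ} (G : Tuple n) (𝒞 : List (List (𝕃 n))) : Set where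
  field
    sound    : All (IsSCC G) 𝒞
    complete : ∀ {S} → IsSCC G S → Any (S ∼[ set ]_) 𝒞
    distinct : AllPairs (λ S T → ¬ S ∼[ set ] T) 𝒞

starSums : ∀ {n} → List (𝕃 n) → List (𝕃 n)
starSums []       = []
starSums (f ∷ fs) = map (f +ˡ_) fs

-- One pass through the body of the loop over the edges, f and g being the
-- normal remainders f′ and g′ of the two ends of the edge.
append : ∀ {n} → 𝕃 n → 𝕃 n → Tuple n → Tuple n
append {n} f g ⟪ L , V , E ⟫ = ⟪ L₂ , proj₁ VE , proj₂ VE ⟫
  where
  L₁ L₂ : List (𝕃 n)
  L₁ = if does ((f ≟ 0ˡ) ×-dec ¬? (g ≟ 0ˡ)) then g ∷ L else L
  L₂ = if does ((g ≟ 1ˡ) ×-dec ¬? (f ≟ 1ˡ)) then (f +ˡ 1ˡ) ∷ L₁ else L₁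

  nonconstant? : ∀ h → Dec (h ≢ 0ˡ × h ≢ 1ˡ)
  nonconstant? h = ¬? (h ≟ 0ˡ) ×-dec ¬? (h ≟ 1ˡ)

  VE : List (𝕃 n) × List (Edge n)
  VE = if does (nonconstant? f ×-dec nonconstant? g ×-dec ¬? (f ≟ g))
       then (f ∷ g ∷ V , (f , g) ∷ E)
       else (V , E)

-- Configurations of a run of crGGCP:
--   ggcp G        GGCP is about to interreduce the first component of G;
--   loop L es G′  inside the loop of GGCP, es being the edges still to visit
--                 and G′ the current value of (L′,V′,E′);
--   comps G′      GGCP has returned G′ to crGGCP;
--   result G′     crGGCP has returned G′.
data Configuration (n : ℕ) : Set where
  ggcp   : Tuple n → Configuration n
  loop   : List (𝕃 n) → List (Edge n) → Tuple n → Configuration n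
  comps  : Tuple n → Configuration n
  result : Tuple n → Configuration n

-- The relation is nondeterministic, since an interreduced generating set and
-- the enumerations of the components may be chosen freely. Two points:
--  * every pass of GGCP starts with an interreduction (see repeat), because
--    the elements appended during a pass may share leading terms with each
--    other, as for x + y and x + z;
--  * in the case odd, the space of all linear polynomials is returned in the
--    form of its generators 1, x₁, …, xₙ, which have distinct leading terms.
data Step {n : ℕ} (σ : TermOrdering n) : Rel (Configuration n) 0ℓ where
  interreduce : ∀ {L L₁ V E} → Interreduces σ L L₁ →
                Step σ (ggcp ⟪ L , V , E ⟫) (loop L₁ E ⟪ L₁ , [] , [] ⟫)
  visit       : ∀ {L f g f′ g′ es G′} → NR σ L f f′ → NR σ L g g′ →
                Step σ (loop L ((f , g) ∷ es) G′) (loop L es (append f′ g′ G′))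
  repeat      : ∀ {L G′} → ¬ L ∼[ set ] Tuple.L G′ →
                Step σ (loop L [] G′) (ggcp G′)
  return      : ∀ {L G′} → L ∼[ set ] Tuple.L G′ →
                Step σ (loop L [] G′) (comps G′)
  odd         : ∀ {G′ 𝒞} → AreAllSCCs G′ 𝒞 → ¬ 2 ∣ length 𝒞 →
                Step σ (comps G′) (result ⟪ 𝕃-generators n , [] , [] ⟫)
  merge       : ∀ {L V E 𝒞} → AreAllSCCs ⟪ L , V , E ⟫ 𝒞 → 2 ∣ length 𝒞 →
                concatMap starSums 𝒞 ≢ [] →
                Step σ (comps ⟪ L , V , E ⟫) (ggcp ⟪ L ++ concatMap starSums 𝒞 , V , E ⟫)
  finish      : ∀ {G′ 𝒞} → AreAllSCCs G′ 𝒞 → 2 ∣ length 𝒞 →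
                concatMap starSums 𝒞 ≡ [] →
                Step σ (comps G′) (result G′)

Steps : ∀ {n} → TermOrdering n → Rel (Configuration n) 0ℓ
Steps σ = Star (Step σ)

IsResult : ∀ {n} → Pred (Configuration n) 0ℓ
IsResult c = ∃[ G′ ] c ≡ result G′

{-# OPTIONS --safe #-}
module Submission where

-- All elements that GGCP appends to L and all sums that crGGCP appends are
-- nonzero and irreducible modulo the interreduced L, so each return to the
-- interreduction strictly enlarges the set of leading terms of the span of L;
-- this bounds the length of a run. The ideal does not change because an edge
-- (f,g) says that (f+1)g vanishes modulo the ideal: this is a preorder "f
-- implies g", it is compatible with normal remainders, and f + g lies in the
-- ideal when f and g imply each other. Normal remainders are unique, hence
-- commute with f ↦ f + 1, which keeps the graph skew-symmetric. Therefore
-- f ↦ f + 1 induces an involution on the strongly connected components; if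
-- their number is odd, some component contains f and f + 1, and 1 is in the
-- ideal. If every component is a singleton, then the graph is acyclic.

open import Defs
open import Algebra.Bundles using (CommutativeRing)
import Algebra.Properties.CommutativeMonoid.Sum as CommutativeMonoidSum
import Algebra.Properties.Monoid.Sum as MonoidSum
import Algebra.Solver.Ring
open import Algebra.Solver.Ring.AlmostCommutativeRing using (fromCommutativeRing; _-Raw-AlmostCommutative⟶_)
open import Data.Bool using (Bool; true; false; _xor_; _∧_; if_then_else_)
open import Data.Bool.Properties as Bool using (xor-assoc; xor-comm; xor-identityˡ; xor-same)
open import Data.Empty using (⊥-elim)
open import Data.Fin as Fin using (Fin; zero; suc)
import Data.Fin.Properties as Fin
open import Data.List using (List; []; _∷_; _++_; length; filter; allFin; map; deduplicate; concatMap; _ʳ++_)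
open import Data.List.Membership.Propositional using (_∈_; find; lose)
open import Data.List.Membership.Propositional.Properties
  using (∈-∃++; ∈-allFin; ∈-filter⁺; ∈-filter⁻; ∈-deduplicate⁺; ∈-deduplicate⁻; ∈-map⁺; ∈-map⁻;
    ∈-concat⁺′; ∈-concat⁻′; ∈-++⁺ˡ; ∈-++⁺ʳ; ∈-++⁻; ∈-tabulate⁻; ∈-tabulate⁺)
import Data.List.Membership.Setoid.Properties as Membershipₛ
open import Data.List.Properties using (length-map)
open import Data.List.Relation.Binary.BagAndSetEquality using (_∼[_]_; set)
open import Data.List.Relation.Binary.Permutation.Propositional using (_↭_; ↭-sym; ↭⇒↭ₛ)
open import Data.List.Relation.Binary.Permutation.Propositional.Properties using (shift; ↭-length; ∈-resp-↭)
import Data.List.Relation.Binary.Permutation.Setoid.Properties as Permutationₛ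
open import Data.List.Relation.Unary.All as All using (All; []; _∷_)
import Data.List.Relation.Unary.All.Properties as All
open import Data.List.Relation.Unary.AllPairs as AllPairs using (AllPairs; []; _∷_)
import Data.List.Relation.Unary.AllPairs.Properties as AllPairs
open import Data.List.Relation.Unary.Any as Any using (here; there; Any)
open import Data.List.Relation.Unary.Any.Properties using (reverse⁺; reverse⁻)
import Data.List.Relation.Unary.Linked.Properties as Linked
import Data.List.Relation.Unary.Unique.DecPropositional.Properties as UniqueDec
import Data.List.Relation.Unary.Unique.DecSetoid.Properties as UniqueDecₛ
open import Data.List.Relation.Unary.Unique.Propositional using (Unique)
import Data.List.Relation.Unary.Unique.Propositional.Properties as Unique
import Data.List.Sort as Sort
open import Data.Maybe using (Maybe; just; nothing)
open import Data.Nat using (ℕ; zero; suc; z≤n; s≤s; _<_; _+_; s≤s⁻¹) renaming (_≤_ to _≤ℕ_)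
open import Data.Nat.Divisibility using (_∣_; ∣m∣n⇒∣m+n; ∣-refl; _∣0; _∣?_)
open import Data.Nat.Properties as ℕ using () renaming (_≟_ to _≟ℕ_)
open import Data.Product using (_×_; _,_; ∃-syntax; proj₁; proj₂; Σ-syntax; swap)
open import Data.Sum using (_⊎_; inj₁; inj₂)
open import Data.Vec using (Vec; []; _∷_; lookup; zipWith; replicate; _[_]≔_)
open import Data.Vec.Properties
  using (zipWith-assoc; zipWith-comm; zipWith-identityˡ; lookup-zipWith; lookup-replicate; lookup∘update;
    lookup∘update′; ≡-dec; tabulate∘lookup; tabulate-cong; zipWith-identityʳ)
open import Function using (_∘_; id; case_of_; _⇔_; mk⇔; Equivalence; flip)
open import Function.Construct.Composition using (_⇔-∘_)
open import Function.Construct.Symmetry using (⇔-sym)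
open import Induction.WellFounded using (Acc; acc)
open import Level using (0ℓ)
open import Relation.Binary using (Rel; IsTotalOrder; DecTotalOrder; Decidable; DecSetoid)
open import Relation.Binary.Construct.Closure.ReflexiveTransitive as Star using (Star; ε; _◅_; _◅◅_)
open import Relation.Binary.Construct.Closure.Transitive using (TransClosure; [_]; _∷_)
open import Relation.Binary.PropositionalEquality
  using (_≡_; _≢_; refl; sym; trans; cong; cong₂; subst; setoid; isEquivalence)
open import Relation.Nullary using (¬_; yes; no; Dec; ¬?; _×-dec_; _→-dec_; map′; _⊎-dec_; does)
open import Relation.Nullary.Decidable using (decidable-stable)
open import Relation.Unary using (Pred) renaming (_⊆_ to _⊆ᵖ_)

-- The case `1ˡ ∈ L` shapes many statements. Division takes place among all polynomials, so `1ˡ`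
-- divides every term: all normal remainders are then `0ˡ`, they need not differ from the dividend
-- by an element of the span of `L`, and they do not commute with adding `1ˡ`. Linear algebra on
-- coefficient vectors describes division only under `¬ 1ˡ ∈ L`. A pass that appends anything has
-- seen a nonzero remainder, which excludes the bad case; and in the bad case the ideal is all of
-- `𝔹 n`. The second obstacle is that the tuple under construction need not be an implication graph
-- structure before all edges have been visited. `Pass` therefore describes it relative to the
-- visited edges, while the invariant of a run carries along the structure being processed.
-- Interreduction, division and enumeration of components are free choices. Termination is therefore
-- accessibility, which covers every run, and each choice is also constructed, so that no run gets
-- stuck.

module _ {n : ℕ} where

  -- Linear polynomials as a vector space over 𝔽₂, and spans.

  +ˡ-assoc : (f g h : 𝕃 n) → (f +ˡ g) +ˡ h ≡ f +ˡ (g +ˡ h)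
  +ˡ-assoc = zipWith-assoc xor-assoc

  +ˡ-comm : (f g : 𝕃 n) → f +ˡ g ≡ g +ˡ f
  +ˡ-comm = zipWith-comm xor-comm

  +ˡ-identityˡ : (f : 𝕃 n) → 0ˡ +ˡ f ≡ f
  +ˡ-identityˡ = zipWith-identityˡ xor-identityˡ

  +ˡ-identityʳ : (f : 𝕃 n) → f +ˡ 0ˡ ≡ f
  +ˡ-identityʳ f = trans (+ˡ-comm f 0ˡ) (+ˡ-identityˡ f)

  +ˡ-self : (f : 𝕃 n) → f +ˡ f ≡ 0ˡ
  +ˡ-self f = go f
    where
    go : ∀ {m} (v : Vec Bool m) → zipWith _xor_ v v ≡ replicate m false
    go []      = refl
    go (b ∷ v) = cong₂ _∷_ (xor-same b) (go v)

  +ˡ-cancelˡ : (f g : 𝕃 n) → f +ˡ (f +ˡ g) ≡ g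
  +ˡ-cancelˡ f g = trans (sym (+ˡ-assoc f f g)) (trans (cong (_+ˡ g) (+ˡ-self f)) (+ˡ-identityˡ g))

  +ˡ-cancelʳ : (f g : 𝕃 n) → (f +ˡ g) +ˡ g ≡ f
  +ˡ-cancelʳ f g = trans (+ˡ-assoc f g g) (trans (cong (f +ˡ_) (+ˡ-self g)) (+ˡ-identityʳ f))

  +ˡ-cancel-mid : (f g h : 𝕃 n) → (f +ˡ g) +ˡ (f +ˡ h) ≡ g +ˡ h
  +ˡ-cancel-mid f g h = trans (cong (_+ˡ (f +ˡ h)) (+ˡ-comm f g))
    (trans (+ˡ-assoc g f _) (cong (g +ˡ_) (+ˡ-cancelˡ f h)))

  +ˡ≡0⇒≡ : {f g : 𝕃 n} → f +ˡ g ≡ 0ˡ → f ≡ g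
  +ˡ≡0⇒≡ {f} {g} eq = trans (sym (+ˡ-cancelʳ f g)) (trans (cong (_+ˡ g) eq) (+ˡ-identityˡ g))

  +ˡ-swap : {f g h : 𝕃 n} → f ≡ g +ˡ h → f +ˡ h ≡ g
  +ˡ-swap {g = g} {h} eq = trans (cong (_+ˡ h) eq) (+ˡ-cancelʳ g h)

  Span-+ : ∀ {L} {f g : 𝕃 n} → Span L f → Span L g → Span L (f +ˡ g)
  Span-+ {g = g} 0∈ q = subst (Span _) (sym (+ˡ-identityˡ g)) q
  Span-+ {g = g} (add {h} {f} h∈L p) q =
    subst (Span _) (sym (+ˡ-assoc h f g)) (add h∈L (Span-+ p q))

  ∈⇒Span : ∀ {L} {f : 𝕃 n} → f ∈ L → Span L f
  ∈⇒Span {f = f} f∈L = subst (Span _) (+ˡ-identityʳ f) (add f∈L 0∈)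

  Span-least : ∀ {L M} → (∀ {h : 𝕃 n} → h ∈ L → Span M h) → ∀ {f} → Span L f → Span M f
  Span-least L⊆M 0∈        = 0∈
  Span-least L⊆M (add h p) = Span-+ (L⊆M h) (Span-least L⊆M p)

  -- Over 𝔽₂ only the parity of the number of uses of `h` matters.
  Span-∷⁻ : ∀ {h L} {f : 𝕃 n} → Span (h ∷ L) f → Span L f ⊎ Span L (h +ˡ f)
  Span-∷⁻ 0∈ = inj₁ 0∈
  Span-∷⁻ {h} (add {f = f} (here refl) p) with Span-∷⁻ p
  ... | inj₁ q = inj₂ (subst (Span _) (sym (+ˡ-cancelˡ h f)) q)
  ... | inj₂ q = inj₁ q
  Span-∷⁻ {h} (add {k} {f} (there k∈L) p) with Span-∷⁻ p
  ... | inj₁ q = inj₁ (add k∈L q)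
  ... | inj₂ q = inj₂ (subst (Span _)
    (trans (sym (+ˡ-assoc k h f)) (trans (cong (_+ˡ f) (+ˡ-comm k h)) (+ˡ-assoc h k f)))
    (add k∈L q))

-- Counting in lists: functional images and involutions.

∈⇒↭ : ∀ {A : Set} {a : A} {xs} → a ∈ xs → ∃[ ys ] xs ↭ a ∷ ys
∈⇒↭ {a = a} a∈xs with ys , zs , refl ← ∈-∃++ a∈xs = ys ++ zs , shift a ys zs

-- Distinct values need distinct preimages, so each preimage can be struck off `xs` once used. A
-- functional relation in place of a function admits `NR σ L`, which is given only as a relation.
length-image-≤ : ∀ {A B : Set} (R : A → B → Set) → (∀ {a y y′} → R a y → R a y′ → y ≡ y′) →
  ∀ {ys} → Unique ys → ∀ xs → (∀ {y} → y ∈ ys → ∃[ a ] (a ∈ xs × R a y)) → length ys ≤ℕ length xs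
length-image-≤ R fun []             xs surj = z≤n
length-image-≤ R fun {ys = y ∷ ys} (y∉ys ∷ u) xs surj
  with a , a∈xs , Ray ← surj (here refl)
  with xs′ , xs↭ ← ∈⇒↭ a∈xs =
  subst (suc (length ys) ≤ℕ_) (sym (↭-length xs↭)) (s≤s (length-image-≤ R fun u xs′ surj′))
  where
  surj′ : ∀ {z} → z ∈ ys → ∃[ w ] (w ∈ xs′ × R w z)
  surj′ z∈ys with w , w∈xs , Rwz ← surj (there z∈ys) with ∈-resp-↭ xs↭ w∈xs
  ... | here refl  = ⊥-elim (All.lookup y∉ys z∈ys (fun Ray Rwz))
  ... | there w∈xs′ = w , w∈xs′ , Rwz

-- Remove an element together with its partner.
involution⇒even : ∀ {A : Set} (_~_ : Rel A 0ℓ) →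
  (∀ {a y} → a ~ y → y ~ a) → (∀ {a y z} → a ~ y → y ~ z → a ~ z) →
  (p : A → A) → (∀ {a y} → a ~ y → p a ~ p y) → (∀ a → p (p a) ≡ a) →
  ∀ {xs} → AllPairs (λ a y → ¬ a ~ y) xs → (∀ {a} → a ∈ xs → ¬ a ~ p a) →
  (∀ {a} → a ∈ xs → ∃[ y ] (y ∈ xs × y ~ p a)) → 2 ∣ length xs
involution⇒even {A} _~_ ~-sym ~-trans p p-cong pp = go _ ℕ.≤-refl
  where
  p-swap : ∀ {a y} → y ~ p a → a ~ p y
  p-swap {a} y~pa = ~-sym (subst (_ ~_) (pp a) (p-cong y~pa))

  -- Two elements leave in each round and what remains is only a permutation of a part of the tail,
  -- so the recursion runs on a bound `k` for the length.
  go : ∀ k {xs} → length xs ≤ℕ k → AllPairs (λ a y → ¬ a ~ y) xs → (∀ {a} → a ∈ xs → ¬ a ~ p a) →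
       (∀ {a} → a ∈ xs → ∃[ y ] (y ∈ xs × y ~ p a)) → 2 ∣ length xs
  go k {[]} _ _ _ _ = 2 ∣0
  go (suc k) {a ∷ xs} (s≤s len) (a≁xs ∷ xs≁) nofix partner with partner (here refl)
  ... | y , here refl , y~pa = ⊥-elim (nofix (here refl) y~pa)
  ... | y , there y∈xs , y~pa with ys , xs↭ ← ∈⇒↭ y∈xs
    with y≁ys ∷ ys≁ ← Permutationₛ.AllPairs-resp-↭ (setoid A) (_∘ ~-sym)
                        ((λ { refl → id }) , λ { refl → id }) (↭⇒↭ₛ xs↭) xs≁ =
    subst (2 ∣_) (cong suc (sym (↭-length xs↭)))
      (∣m∣n⇒∣m+n ∣-refl (go k (ℕ.≤-trans (ℕ.n≤1+n _) (subst (_≤ℕ k) (↭-length xs↭) len)) ys≁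
        (nofix ∘ there ∘ ys⊆xs) partner′))
    where
    ys⊆xs : ∀ {z} → z ∈ ys → z ∈ xs
    ys⊆xs = ∈-resp-↭ (↭-sym xs↭) ∘ there

    partner′ : ∀ {z} → z ∈ ys → ∃[ w ] (w ∈ ys × w ~ p z)
    partner′ z∈ys with partner (there (ys⊆xs z∈ys))
    ... | w , here refl , w~pz = ⊥-elim (All.lookup y≁ys z∈ys (~-trans y~pa (~-sym (p-swap w~pz))))
    ... | w , there w∈xs , w~pz with ∈-resp-↭ xs↭ w∈xs
    ... | here refl = ⊥-elim (All.lookup a≁xs (ys⊆xs z∈ys) (~-trans (p-swap y~pa) (~-sym (p-swap w~pz))))
    ... | there w∈ys = w , w∈ys , w~pz

-- Leading terms and reduction

true⊎false : (b : Bool) → b ≡ true ⊎ b ≡ false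
true⊎false true  = inj₁ refl
true⊎false false = inj₂ refl

true≢false : ∀ {b} → b ≡ true → b ≢ false
true≢false refl ()

lookup-ext : ∀ {m} {v w : Vec Bool m} → (∀ i → lookup v i ≡ lookup w i) → v ≡ w
lookup-ext {v = v} {w} eq = trans (sym (tabulate∘lookup v)) (trans (tabulate-cong eq) (tabulate∘lookup w))

module _ {n : ℕ} where

  lookup-+ : (f g : 𝕃 n) (i : Fin (suc n)) → lookup (f +ˡ g) i ≡ lookup f i xor lookup g i
  lookup-+ f g i = lookup-zipWith _xor_ i f g

  lookup-0ˡ : (i : Fin (suc n)) → lookup {A = Bool} 0ˡ i ≡ false
  lookup-0ˡ i = lookup-replicate i false

  lookup-+⁻ : ∀ {f g : 𝕃 n} {i} → lookup (f +ˡ g) i ≡ true → lookup f i ≡ true ⊎ lookup g i ≡ true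
  lookup-+⁻ {f} {g} {i} eq with lookup f i in p
  ... | true  = inj₁ refl
  ... | false = inj₂ (trans (trans (cong (_xor lookup g i) (sym p)) (sym (lookup-+ f g i))) eq)

  lookup-+-true-false : ∀ {f g : 𝕃 n} {i} → lookup f i ≡ true → lookup g i ≡ false → lookup (f +ˡ g) i ≡ true
  lookup-+-true-false {f} {g} {i} p q = trans (lookup-+ f g i) (cong₂ _xor_ p q)

  lookup-+-false : ∀ {f g : 𝕃 n} {i} → lookup f i ≡ false → lookup g i ≡ false → lookup (f +ˡ g) i ≡ false
  lookup-+-false {f} {g} {i} p q = trans (lookup-+ f g i) (cong₂ _xor_ p q)

  lookup-+-true-true : ∀ {f g : 𝕃 n} {i} → lookup f i ≡ true → lookup g i ≡ true → lookup (f +ˡ g) i ≡ false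
  lookup-+-true-true {f} {g} {i} p q = trans (lookup-+ f g i) (cong₂ _xor_ p q)

  term-suc-≡ : (i : Fin n) → lookup (term (suc i)) i ≡ 1
  term-suc-≡ i = lookup∘update i 1ᵗ 1

  term-suc-≢ : {i j : Fin n} → i ≢ j → lookup (term (suc i)) j ≡ 0
  term-suc-≢ {i} {j} i≢j = trans (lookup∘update′ (i≢j ∘ sym) 1ᵗ 1) (lookup-replicate j 0)

  term-injective : {i j : Fin (suc n)} → term i ≡ term j → i ≡ j
  term-injective {zero}  {zero}  eq = refl
  term-injective {zero}  {suc j} eq
    with () ← trans (sym (lookup-replicate j 0)) (trans (cong (λ t → lookup t j) eq) (term-suc-≡ j))
  term-injective {suc i} {zero}  eq
    with () ← trans (sym (term-suc-≡ i)) (trans (cong (λ t → lookup t i) eq) (lookup-replicate i 0))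
  term-injective {suc i} {suc j} eq with i Fin.≟ j
  ... | yes refl = refl
  ... | no i≢j
    with () ← trans (sym (term-suc-≡ i)) (trans (cong (λ t → lookup t i) eq) (term-suc-≢ (i≢j ∘ sym)))

  Supp⇒true : {f : 𝕃 n} {i : Fin (suc n)} → Supp f (term i) → lookup f i ≡ true
  Supp⇒true {i = i} (j , fj , eq) with refl ← term-injective {i = j} {j = i} eq = fj

module _ {n : ℕ} (σ : TermOrdering n) where

  open TermOrdering σ
  open IsTotalOrder isTotalOrder using (total; antisym)
    renaming (refl to ≤-refl; trans to ≤-trans; reflexive to ≤-reflexive)

  infix 4 _⊑_ _≤?_ _⊑?_

  -- Equality of exponent vectors is decidable; for different terms, totality and antisymmetry
  -- settle the comparison.
  _≤?_ : Decidable _≤_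
  s ≤? t with ≡-dec _≟ℕ_ s t
  ... | yes s≡t = yes (≤-reflexive s≡t)
  ... | no s≢t with total s t
  ...   | inj₁ s≤t = yes s≤t
  ...   | inj₂ t≤s = no λ s≤t → s≢t (antisym s≤t t≤s)

  -- Coefficient positions stand in for terms of degree at most one. As `term` is injective nothing
  -- is lost, and leading terms become elements of a finite set, where `Lead` is decidable.
  Position : Set
  Position = Fin (suc n)

  _⊑_ : Position → Position → Set
  i ⊑ j = term i ≤ term j

  _⊑?_ : Decidable _⊑_
  i ⊑? j = term i ≤? term j

  ⊑-antisym : ∀ i j → i ⊑ j → j ⊑ i → i ≡ j
  ⊑-antisym i j p q = term-injective {i = i} {j} (antisym p q)

  record Lead (f : 𝕃 n) (i : Position) : Set where
    constructor _,_
    field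
      occurs  : lookup f i ≡ true
      maximal : ∀ j → lookup f j ≡ true → j ⊑ i

  Lead? : ∀ f i → Dec (Lead f i)
  Lead? f i = map′ (λ (fi , max) → fi , max) (λ (fi , max) → fi , max)
    ((lookup f i Bool.≟ true) ×-dec Fin.all? (λ j → (lookup f j Bool.≟ true) →-dec (j ⊑? i)))

  Lead-unique : ∀ {f} i j → Lead f i → Lead f j → i ≡ j
  Lead-unique i j (fi , max-i) (fj , max-j) = ⊑-antisym i j (max-j _ fi) (max-i _ fj)

  Lead⇒IsLT : ∀ {f i} → Lead f i → IsLT σ f (term i)
  Lead⇒IsLT {f} {i} (fi , max) = (i , fi , refl) , λ { _ (j , fj , refl) → max j fj }

  IsLT⇒Lead : ∀ {f t} → IsLT σ f t → ∃[ i ] (term i ≡ t × Lead f i)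
  IsLT⇒Lead ((i , fi , refl) , max) = i , refl , fi , λ j fj → max _ (j , fj , refl)

  ≢0⇒Lead : ∀ {f} → f ≢ 0ˡ → ∃[ i ] Lead f i
  ≢0⇒Lead {f} f≢0 with go (allFin (suc n))
    where
    go : ∀ is → (∀ {j} → j ∈ is → lookup f j ≡ false) ⊎
                (∃[ i ] (lookup f i ≡ true × (∀ {j} → j ∈ is → lookup f j ≡ true → j ⊑ i)))
    go [] = inj₁ λ ()
    go (i ∷ is) with go is | true⊎false (lookup f i)
    ... | inj₁ none | inj₂ fi = inj₁ λ { (here refl) → fi ; (there j∈) → none j∈ }
    ... | inj₁ none | inj₁ fi = inj₂ (i , fi ,
      λ { (here refl) _ → ≤-refl ; (there j∈) fj → ⊥-elim (true≢false fj (none j∈)) })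
    ... | inj₂ (k , fk , max) | inj₂ fi = inj₂ (k , fk ,
      λ { (here refl) fj → ⊥-elim (true≢false fj fi) ; (there j∈) → max j∈ })
    ... | inj₂ (k , fk , max) | inj₁ fi with total (term i) (term k)
    ...   | inj₁ i⊑k = inj₂ (k , fk , λ { (here refl) _ → i⊑k ; (there j∈) → max j∈ })
    ...   | inj₂ k⊑i = inj₂ (i , fi , λ { (here refl) _ → ≤-refl ; (there j∈) fj → ≤-trans (max j∈ fj) k⊑i })
  ... | inj₁ none = ⊥-elim (f≢0 (lookup-ext λ i → trans (none (∈-allFin i)) (sym (lookup-0ˡ i))))
  ... | inj₂ (i , fi , max) = i , fi , λ j → max (∈-allFin j)

  Lead-+ : ∀ {f g i j} → Lead f i → Lead g j → j ⊑ i → i ≢ j → Lead (f +ˡ g) i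
  Lead-+ {f} {g} {i} {j} (fi , max-i) (gj , max-j) j⊑i i≢j =
    lookup-+-true-false {f = f} {g} {i} fi gi , λ k k∈ → bound k (lookup-+⁻ {f = f} {g} {k} k∈)
    where
    gi : lookup g i ≡ false
    gi with true⊎false (lookup g i)
    ... | inj₁ gi = ⊥-elim (i≢j (⊑-antisym i j (max-j i gi) j⊑i))
    ... | inj₂ gi = gi
    bound : ∀ k → lookup f k ≡ true ⊎ lookup g k ≡ true → k ⊑ i
    bound k (inj₁ fk) = max-i _ fk
    bound k (inj₂ gk) = ≤-trans (max-j _ gk) j⊑i

  LeadsLike : List (𝕃 n) → 𝕃 n → Set
  LeadsLike L r = ∃[ h ] ∃[ i ] (h ∈ L × Lead h i × Lead r i)

  -- Different leading terms cannot cancel, so a sum is led by the largest leading term among its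
  -- summands.
  Lead-Span : ∀ {L} → DistinctLTs σ L → ∀ {r} → Span L r → r ≡ 0ˡ ⊎ LeadsLike L r
  Lead-Span {[]} _ 0∈ = inj₁ refl
  Lead-Span {h ∷ L} (nz , inj) {r} r∈ = cases (Any.any? (h ≟_) L) (Span-∷⁻ r∈)
    where
    distinct : DistinctLTs σ L
    distinct = nz ∘ there , λ p q → inj (there p) (there q)
    tail : Span L r → r ≡ 0ˡ ⊎ LeadsLike (h ∷ L) r
    tail r∈L with Lead-Span distinct r∈L
    ... | inj₁ r≡0               = inj₁ r≡0
    ... | inj₂ (k , i , k∈L , p) = inj₂ (k , i , there k∈L , p)
    cases : Dec (h ∈ L) → Span L r ⊎ Span L (h +ˡ r) → r ≡ 0ˡ ⊎ LeadsLike (h ∷ L) r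
    cases _         (inj₁ r∈L) = tail r∈L
    -- Lists may repeat entries; a second copy of `h` adds nothing to the span.
    cases (yes h∈L) (inj₂ s∈L) = tail (subst (Span L) (+ˡ-cancelˡ h r) (add h∈L s∈L))
    cases (no h∉L)  (inj₂ s∈L) with Lead-Span distinct s∈L | ≢0⇒Lead (nz (here refl))
    ... | inj₁ s≡0                     | i , Lh with refl ← +ˡ≡0⇒≡ s≡0 = inj₂ (h , i , here refl , Lh , Lh)
    ... | inj₂ (k , j , k∈L , Lk , Ls) | i , Lh = compare (total (term i) (term j))
      where
      i≢j : i ≢ j
      i≢j refl = h∉L (subst (_∈ L) (sym (inj (here refl) (there k∈L) (Lead⇒IsLT Lh) (Lead⇒IsLT Lk))) k∈L)
      compare : i ⊑ j ⊎ j ⊑ i → r ≡ 0ˡ ⊎ LeadsLike (h ∷ L) r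
      compare (inj₁ i⊑j) = inj₂ (k , j , there k∈L , Lk ,
        subst (λ f → Lead f j) (trans (+ˡ-comm _ h) (+ˡ-cancelˡ h r)) (Lead-+ Ls Lh i⊑j (i≢j ∘ sym)))
      compare (inj₂ j⊑i) = inj₂ (h , i , here refl , Lh ,
        subst (λ f → Lead f i) (+ˡ-cancelˡ h r) (Lead-+ Lh Ls j⊑i i≢j))

  -- Irreducibility restricted to division steps with `t = 1ᵗ`. It agrees with `Irreducible` unless
  -- `1ˡ` is among the divisors. The divisors form a predicate, so that all monomials can be taken
  -- as well.
  Clean : Pred (𝕃 n) 0ℓ → 𝕃 n → Set
  Clean A f = ∀ {p i} → A p → Lead p i → lookup f i ≡ false

  Clean-Span : ∀ {L} → DistinctLTs σ L → ∀ {r} → Span L r → Clean (_∈ L) r → r ≡ 0ˡ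
  Clean-Span d r∈ clean with Lead-Span d r∈
  ... | inj₁ eq = eq
  ... | inj₂ (h , i , h∈L , Lh , ri , _) = ⊥-elim (true≢false ri (clean h∈L Lh))

  IsLeading : List (𝕃 n) → Position → Set
  IsLeading L i = Any (λ h → Lead h i) L

  nonLeading? : ∀ L i → Dec (¬ IsLeading L i)
  nonLeading? L i = ¬? (Any.any? (λ h → Lead? h i) L)

  nonLeading : List (𝕃 n) → List Position
  nonLeading L = filter (nonLeading? L) (allFin (suc n))

  -- For distinct leading terms this is the codimension of the span in `𝕃 n`; it is the measure that
  -- bounds a run.
  codim : List (𝕃 n) → ℕ
  codim L = length (nonLeading L)

  -- Leading positions of `L` remain leading for `M`. That of `r` is gained: it is leading for `M`
  -- because `r` lies in the span, and not for `L` because `r` is clean.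
  codim-< : ∀ {L M} → DistinctLTs σ L → DistinctLTs σ M → (∀ {f} → Span L f → Span M f) →
            ∀ {r} → Span M r → r ≢ 0ˡ → Clean (_∈ L) r → codim M < codim L
  codim-< {L} {M} dL dM L⊆M {r} r∈M r≢0 clean = new (Lead-Span dM r∈M)
    where
    leading⊆ : ∀ {i} → IsLeading L i → IsLeading M i
    leading⊆ {i} Li with h , h∈L , Lh ← find Li with Lead-Span dM (L⊆M (∈⇒Span h∈L))
    ... | inj₁ h≡0 = ⊥-elim (proj₁ dL h∈L h≡0)
    ... | inj₂ (k , j , k∈M , Lk , Lh′) with refl ← Lead-unique i j Lh Lh′ = lose k∈M Lk

    new : r ≡ 0ˡ ⊎ (∃[ h ] ∃[ i ] (h ∈ M × Lead h i × Lead r i)) → codim M < codim L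
    new (inj₁ r≡0) = ⊥-elim (r≢0 r≡0)
    new (inj₂ (h , i , h∈M , Lh , ri , _)) =
      length-image-≤ _≡_ (λ { refl refl → refl })
        (All.tabulate (λ { j∈ refl → proj₂ (∈-filter⁻ (nonLeading? M) {xs = allFin (suc n)} j∈) (lose h∈M Lh) })
         ∷ Unique.filter⁺ (nonLeading? M) (Unique.allFin⁺ (suc n)))
        (nonLeading L)
        λ { (here refl) → i , ∈-filter⁺ (nonLeading? L) (∈-allFin i)
              (λ Li → let k , k∈L , Lk = find Li in true≢false ri (clean k∈L Lk)) , refl
          ; {j} (there j∈) → j , ∈-filter⁺ (nonLeading? L) (∈-allFin j)
              (proj₂ (∈-filter⁻ (nonLeading? M) {xs = allFin (suc n)} j∈) ∘ leading⊆) , refl }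

  -- The order is reversed so that sorting lists the largest position first.
  descending : DecTotalOrder _ _ _
  descending = record
    { Carrier = Position
    ; _≈_ = _≡_
    ; _≤_ = λ i j → j ⊑ i
    ; isDecTotalOrder = record
      { isTotalOrder = record
        { isPartialOrder = record
          { isPreorder = record
            { isEquivalence = isEquivalence
            ; reflexive = λ { refl → ≤-refl }
            ; trans = λ p q → ≤-trans q p
            }
          ; antisym = λ {i} {j} p q → ⊑-antisym i j q p
          }
        ; total = λ i j → total (term j) (term i)
        }
      ; _≟_ = Fin._≟_
      ; _≤?_ = λ i j → j ⊑? i
      }
    }

  Reduction : Pred (𝕃 n) 0ℓ → 𝕃 n → 𝕃 n → Set
  Reduction A f f′ = ∃[ p ] ∃[ i ] (A p × Lead p i × lookup f i ≡ true × f′ ≡ f +ˡ p)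

  -- Clearing the positions in descending order: a reduction at i does not
  -- touch the positions above i.
  reduce : (A : Pred (𝕃 n) 0ℓ) → (∀ i → Dec (∃[ p ] (A p × Lead p i))) →
           ∀ f → ∃[ r ] (Star (Reduction A) f r × Clean A r)
  reduce A A? f = go (sort (allFin (suc n)))
                    (Linked.Linked⇒AllPairs (λ p q → ≤-trans q p) (sort-↗ (allFin (suc n)))) f
                    λ i → inj₁ (∈-resp-↭ (↭-sym (sort-↭ (allFin (suc n)))) (∈-allFin i))
    where
    open Sort descending using (sort; sort-↭; sort-↗)

    CleanAt : 𝕃 n → Position → Set
    CleanAt f i = ∀ {p} → A p → Lead p i → lookup f i ≡ false

    -- The last argument is the loop invariant: a position is still to be visited, or it is clean
    -- and lies above all that are.
    go : ∀ is → AllPairs (λ i j → j ⊑ i) is → ∀ f → (∀ i → i ∈ is ⊎ (CleanAt f i × (∀ {j} → j ∈ is → j ⊑ i))) →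
         ∃[ r ] (Star (Reduction A) f r × Clean A r)
    go [] _ f inv = f , ε , λ {_} {i} Ap Lp → case inv i of λ { (inj₂ (clean , _)) → clean Ap Lp }
    go (i ∷ is) (i⊒is ∷ sorted) f inv with true⊎false (lookup f i)
    ... | inj₂ fi = go is sorted f inv′
      where
      inv′ : ∀ k → k ∈ is ⊎ (CleanAt f k × (∀ {j} → j ∈ is → j ⊑ k))
      inv′ k with inv k
      ... | inj₁ (here refl) = inj₂ ((λ _ _ → fi) , All.lookup i⊒is)
      ... | inj₁ (there k∈) = inj₁ k∈
      ... | inj₂ (clean , above) = inj₂ (clean , above ∘ there)
    ... | inj₁ fi with A? i
    ...   | no ∄p = go is sorted f inv′
      where
      inv′ : ∀ k → k ∈ is ⊎ (CleanAt f k × (∀ {j} → j ∈ is → j ⊑ k))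
      inv′ k with inv k
      ... | inj₁ (here refl) = inj₂ ((λ Ap Lp → ⊥-elim (∄p (_ , Ap , Lp))) , All.lookup i⊒is)
      ... | inj₁ (there k∈) = inj₁ k∈
      ... | inj₂ (clean , above) = inj₂ (clean , above ∘ there)
    ...   | yes (p , Ap , Lp) = let r , steps , clean = go is sorted (f +ˡ p) inv′ in
      r , (p , i , Ap , Lp , fi , refl) ◅ steps , clean
      where
      inv′ : ∀ k → k ∈ is ⊎ (CleanAt (f +ˡ p) k × (∀ {j} → j ∈ is → j ⊑ k))
      inv′ k with inv k
      ... | inj₁ (here refl) = inj₂ ((λ _ _ → lookup-+-true-true {f = f} {p} {i} fi (Lead.occurs Lp)) , All.lookup i⊒is)
      ... | inj₁ (there k∈) = inj₁ k∈
      ... | inj₂ (clean , above) = inj₂ ((λ Aq Lq → lookup-+-false {f = f} {p} {k} (clean Aq Lq) pk) , above ∘ there)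
        where
        pk : lookup p k ≡ false
        pk with true⊎false (lookup p k)
        ... | inj₂ pk = pk
        -- A position `k` above `i` that occurs in `p` must be the leading position `i` itself; but
        -- `k` is clean, whereas `f` has a coefficient at `i`.
        ... | inj₁ pk with refl ← ⊑-antisym i k (above (here refl)) (Lead.maximal Lp k pk) =
          ⊥-elim (true≢false fi (clean Ap Lp))

  leader? : ∀ L i → Dec (∃[ p ] (p ∈ L × Lead p i))
  leader? L i = map′ find (λ { (_ , p∈L , Lp) → lose p∈L Lp }) (Any.any? (λ h → Lead? h i) L)

  Reduction-Span : ∀ {L f r} → Star (Reduction (_∈ L)) f r → Span L (f +ˡ r)
  Reduction-Span {L} {f} ε = subst (Span L) (sym (+ˡ-self f)) 0∈
  Reduction-Span {L} {f} {r} ((p , i , p∈L , _ , _ , refl) ◅ steps) =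
    subst (Span L) (trans (cong (p +ˡ_) (trans (cong (_+ˡ r) (+ˡ-comm f p)) (+ˡ-assoc p f r))) (+ˡ-cancelˡ p _))
      (add p∈L (Reduction-Span steps))

  -- Gaussian elimination by insertion: the remainder of `h` avoids all leading positions of `L′`,
  -- so its own is new unless it is zero. The elements of `L′` may stay as they are, since only
  -- leading terms have to differ.
  interreduction : ∀ L → ∃[ L′ ] Interreduces σ L L′
  interreduction [] = [] , (id , id) , (λ ()) , λ ()
  interreduction (h ∷ L) with interreduction L
  ... | L′ , (L′⊆L , L⊆L′) , nz , inj with reduce (_∈ L′) (leader? L′) h
  ...   | r , steps , clean with r ≟ 0ˡ
  ...     | yes refl = L′ , (Span-least (λ {k} k∈ → Span-least (∈⇒Span ∘ there) (L′⊆L (∈⇒Span k∈)))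
                             , Span-least λ { (here refl) → subst (Span L′) (+ˡ-identityʳ h) (Reduction-Span steps)
                                            ; (there k∈L) → L⊆L′ (∈⇒Span k∈L) }) , nz , inj
  ...     | no r≢0 = r ∷ L′ , (Span-least to , Span-least from) , nz′ , inj′
    where
    h+r∈ : Span L′ (h +ˡ r)
    h+r∈ = Reduction-Span steps
    to : ∀ {k} → k ∈ r ∷ L′ → Span (h ∷ L) k
    to (here refl) = subst (Span _) (+ˡ-cancelˡ h r) (add (here refl) (Span-least (∈⇒Span ∘ there) (L′⊆L h+r∈)))
    to (there k∈) = Span-least (∈⇒Span ∘ there) (L′⊆L (∈⇒Span k∈))
    from : ∀ {k} → k ∈ h ∷ L → Span (r ∷ L′) k
    from (here refl) = subst (Span _) (trans (cong (r +ˡ_) (+ˡ-comm h r)) (+ˡ-cancelˡ r h))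
      (add (here refl) (Span-least (∈⇒Span ∘ there) h+r∈))
    from (there k∈) = Span-least (∈⇒Span ∘ there) (L⊆L′ (∈⇒Span k∈))
    nz′ : ∀ {k} → k ∈ r ∷ L′ → k ≢ 0ˡ
    nz′ (here refl) = r≢0
    nz′ (there k∈) = nz k∈
    fresh : ∀ {k t} → k ∈ L′ → IsLT σ k t → ¬ Supp r t
    fresh k∈ lt rt with i , refl , Lk ← IsLT⇒Lead lt = true≢false (Supp⇒true {f = r} {i} rt) (clean {i = i} k∈ Lk)
    inj′ : ∀ {k k′ t} → k ∈ r ∷ L′ → k′ ∈ r ∷ L′ → IsLT σ k t → IsLT σ k′ t → k ≡ k′
    inj′ (here refl) (here refl) _ _ = refl
    inj′ (here refl) (there k∈) p q = ⊥-elim (fresh k∈ q (proj₁ p))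
    inj′ (there k∈) (here refl) p q = ⊥-elim (fresh k∈ p (proj₁ q))
    inj′ (there k∈) (there k′∈) p q = inj k∈ k′∈ p q

-- Normal remainders

open Equivalence using (to; from)

xor-cong-⇔ : ∀ {A B C : Set} → B ⇔ C → ((A × ¬ B) ⊎ (¬ A × B)) ⇔ ((A × ¬ C) ⊎ (¬ A × C))
xor-cong-⇔ e = mk⇔
  (λ { (inj₁ (a , ¬b)) → inj₁ (a , ¬b ∘ from e) ; (inj₂ (¬a , b)) → inj₂ (¬a , to e b) })
  (λ { (inj₁ (a , ¬c)) → inj₁ (a , ¬c ∘ to e) ; (inj₂ (¬a , c)) → inj₂ (¬a , from e c) })

module _ {n : ℕ} where

  ·-identityˡ : (t : Term n) → 1ᵗ · t ≡ t
  ·-identityˡ = zipWith-identityˡ ℕ.+-identityˡ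

  ·-identityʳ : (t : Term n) → t · 1ᵗ ≡ t
  ·-identityʳ = zipWith-identityʳ ℕ.+-identityʳ

  -- The product has a positive exponent at `i`, which among the terms of degree at most one only
  -- the variable itself has; cancelling it leaves the cofactor 1.
  ·-term-suc : ∀ (t : Term n) i k → t · term (suc i) ≡ term k → t ≡ 1ᵗ × suc i ≡ k
  ·-term-suc t i k eq with suc-i≡k k eq
    where
    suc-i≡k : ∀ k → t · term (suc i) ≡ term k → suc i ≡ k
    suc-i≡k k eq = position k (sym (trans (cong (λ s → lookup s i) (sym eq))
      (trans (lookup-zipWith _+_ i t (term (suc i))) (trans (cong (lookup t i +_) (term-suc-≡ i)) (ℕ.+-comm _ 1)))))
      where
      position : ∀ k {m} → suc m ≡ lookup (term k) i → suc i ≡ k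
      position zero    p with () ← trans p (lookup-replicate i 0)
      position (suc k) p with k Fin.≟ i
      ... | yes refl = refl
      ... | no k≢i with () ← trans p (term-suc-≢ k≢i)
  ... | refl = t≡1 , refl
    where
    t≡1 : t ≡ 1ᵗ
    t≡1 = trans (sym (tabulate∘lookup t)) (trans (tabulate-cong λ j →
      ℕ.+-cancelʳ-≡ (lookup (term (suc i)) j) (lookup t j) (lookup (1ᵗ {n}) j)
        (trans (sym (lookup-zipWith _+_ j t (term (suc i))))
          (trans (cong (λ s → lookup s j) (trans eq (sym (·-identityˡ _)))) (lookup-zipWith _+_ j 1ᵗ (term (suc i))))))
      (tabulate∘lookup 1ᵗ))

  monomial : Fin (suc n) → 𝕃 n
  monomial i = 0ˡ [ i ]≔ true

  monomial-≡ : ∀ i → lookup (monomial i) i ≡ true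
  monomial-≡ i = lookup∘update i 0ˡ true

  monomial-true : ∀ {i j} → lookup (monomial i) j ≡ true → j ≡ i
  monomial-true {i} {j} eq with j Fin.≟ i
  ... | yes j≡i = j≡i
  ... | no j≢i = ⊥-elim (true≢false eq (trans (lookup∘update′ j≢i 0ˡ true) (lookup-0ˡ {n} j)))

  Supp-+ : ∀ (f g : 𝕃 n) s → Supp (f +ˡ g) s ⇔ ((Supp f s × ¬ Supp g s) ⊎ (¬ Supp f s × Supp g s))
  Supp-+ f g s = mk⇔ there′ back
    where
    there′ : Supp (f +ˡ g) s → (Supp f s × ¬ Supp g s) ⊎ (¬ Supp f s × Supp g s)
    there′ (i , fgi , refl) with true⊎false (lookup f i) | true⊎false (lookup g i)
    ... | inj₁ fi | inj₁ gi = ⊥-elim (true≢false fgi (lookup-+-true-true {f = f} {g} {i} fi gi))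
    ... | inj₁ fi | inj₂ gi = inj₁ ((i , fi , refl) , λ gs → true≢false (Supp⇒true {f = g} {i} gs) gi)
    ... | inj₂ fi | inj₁ gi = inj₂ ((λ fs → true≢false (Supp⇒true {f = f} {i} fs) fi) , i , gi , refl)
    ... | inj₂ fi | inj₂ gi = ⊥-elim (true≢false fgi (lookup-+-false {f = f} {g} {i} fi gi))
    back : (Supp f s × ¬ Supp g s) ⊎ (¬ Supp f s × Supp g s) → Supp (f +ˡ g) s
    back (inj₁ ((i , fi , refl) , ¬gs)) with true⊎false (lookup g i)
    ... | inj₁ gi = ⊥-elim (¬gs (i , gi , refl))
    ... | inj₂ gi = i , lookup-+-true-false {f = f} {g} {i} fi gi , refl
    back (inj₂ (¬fs , (i , gi , refl))) with true⊎false (lookup f i)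
    ... | inj₁ fi = ⊥-elim (¬fs (i , fi , refl))
    ... | inj₂ fi = i , trans (cong (λ h → lookup h i) (+ˡ-comm f g)) (lookup-+-true-false {f = g} {f} {i} gi fi) , refl

  Supp-ext : ∀ {f g : 𝕃 n} → (∀ s → Supp f s ⇔ Supp g s) → f ≡ g
  Supp-ext {f} {g} f⇔g = lookup-ext go
    where
    go : ∀ i → lookup f i ≡ lookup g i
    go i with true⊎false (lookup f i) | true⊎false (lookup g i)
    ... | inj₁ fi | inj₁ gi = trans fi (sym gi)
    ... | inj₂ fi | inj₂ gi = trans fi (sym gi)
    ... | inj₁ fi | inj₂ gi = ⊥-elim (true≢false (Supp⇒true {f = g} {i} (to (f⇔g (term i)) (i , fi , refl))) gi)
    ... | inj₂ fi | inj₁ gi = ⊥-elim (true≢false (Supp⇒true {f = f} {i} (from (f⇔g (term i)) (i , gi , refl))) fi)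

  1·Supp : ∀ (h : 𝕃 n) s → (1ᵗ ·Supp h) s ⇔ Supp h s
  1·Supp h s = mk⇔ (λ { (u , hu , refl) → subst (Supp h) (sym (·-identityˡ u)) hu })
                     (λ hs → s , hs , sym (·-identityˡ s))

  1ˡ-true : ∀ {j} → lookup (1ˡ {n}) j ≡ true → j ≡ zero
  1ˡ-true {zero}  _  = refl
  1ˡ-true {suc j} eq = ⊥-elim (true≢false eq (lookup-replicate j false))

  term·Supp-1ˡ : ∀ i s → (term i ·Supp 1ˡ) s ⇔ Supp (monomial i) s
  term·Supp-1ˡ i s = mk⇔ there′ λ { (j , eq , refl) →
      1ᵗ , (zero , refl , refl) , trans (cong term (monomial-true {i} {j} eq)) (sym (·-identityʳ _)) }
    where
    there′ : (term i ·Supp 1ˡ) s → Supp (monomial i) s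
    there′ (_ , (j , eq , refl) , refl) with refl ← 1ˡ-true {j} eq = i , monomial-≡ i , sym (·-identityʳ _)

module _ {n : ℕ} (σ : TermOrdering n) where

  open TermOrdering σ
  open IsTotalOrder isTotalOrder using (antisym) renaming (refl to ≤-refl)

  _∈?_ : (f : 𝕃 n) (L : List (𝕃 n)) → Dec (f ∈ L)
  f ∈? L = Any.any? (f ≟_) L

  Lead-monomial : ∀ i → Lead σ (monomial i) i
  Lead-monomial i = monomial-≡ i , λ j eq → subst (λ k → _⊑_ σ k i) (sym (monomial-true {i = i} {j} eq)) ≤-refl

  Lead-1ˡ : Lead σ 1ˡ zero
  Lead-1ˡ = refl , λ j eq → subst (λ k → _⊑_ σ k zero) (sym (1ˡ-true {j = j} eq)) ≤-refl

  -- Position `zero` carries the term 1, the minimum of the ordering, so nothing else can occur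
  -- below it.
  Lead-zero : ∀ {h} → Lead σ h zero → h ≡ 1ˡ
  Lead-zero {h} (h0 , max) = lookup-ext go
    where
    go : ∀ i → lookup h i ≡ lookup (1ˡ {n}) i
    go zero = h0
    go (suc i) with true⊎false (lookup h (suc i))
    ... | inj₂ hi = trans hi (sym (lookup-replicate i false))
    ... | inj₁ hi with () ← ⊑-antisym σ (suc i) zero (max (suc i) hi) (1-minimum _)

  division-step : ∀ {L f h t i k p} → h ∈ L → Lead σ h i → t · term i ≡ term k → lookup f k ≡ true →
    (∀ s → (t ·Supp h) s ⇔ Supp p s) → σ , L ⊢ f ⟶ (f +ˡ p)
  division-step {f = f} {t = t} {i} {k} {p} h∈L Lh eq fk tp = record
    { divisor  = h∈L
    ; leading  = Lead⇒IsLT σ Lh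
    ; occurs   = k , fk , sym eq
    ; subtract = λ s → xor-cong-⇔ (⇔-sym (tp s)) ⇔-∘ Supp-+ f p s
    }

  Irreducible⇒Clean : ∀ {L} r → Irreducible σ L r → Clean σ (_∈ L) r
  Irreducible⇒Clean {L} r irr {i = i} h∈L Lh with true⊎false (lookup r i)
  ... | inj₂ ri = ri
  ... | inj₁ ri = ⊥-elim (irr {t = 1ᵗ} h∈L (Lead⇒IsLT σ Lh) (i , ri , sym (·-identityˡ _)))

  Clean⇒Irreducible : ∀ {L} r → ¬ 1ˡ ∈ L → Clean σ (_∈ L) r → Irreducible σ L r
  Clean⇒Irreducible {L} r 1∉L clean {t = t} h∈L lt (k , rk , eq) with IsLT⇒Lead σ lt
  ... | zero , refl , Lh = 1∉L (subst (_∈ L) (Lead-zero Lh) h∈L)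
  ... | suc i , refl , Lh with refl ← proj₂ (·-term-suc t i k (sym eq)) = true≢false rk (clean h∈L Lh)

  NR-unit : ∀ {L f r} → 1ˡ ∈ L → NR σ L f r → r ≡ 0ˡ
  NR-unit {r = r} 1∈L (_ , irr) = lookup-ext go
    where
    go : ∀ i → lookup r i ≡ lookup (0ˡ {n}) i
    go i with true⊎false (lookup r i)
    ... | inj₁ ri = ⊥-elim (irr {t = term i} 1∈L (Lead⇒IsLT σ Lead-1ˡ) (i , ri , sym (·-identityʳ _)))
    ... | inj₂ ri = trans ri (sym (lookup-0ˡ {n} i))

  NR-exists : ∀ L f → ∃[ r ] NR σ L f r
  NR-exists L f with 1ˡ ∈? L
  ... | no 1∉L with r , steps , clean ← reduce σ (_∈ L) (leader? σ L) f =
    r , Star.map (λ { (p , i , p∈L , Lp , fi , refl) → division-step p∈L Lp (·-identityˡ _) fi (1·Supp p) }) steps ,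
    Clean⇒Irreducible r 1∉L clean
  -- A division by `1ˡ` with cofactor `term i` removes the single monomial at `i`. Reduction by all
  -- monomials is thus a division by `L`, and it ends in the zero polynomial.
  ... | yes 1∈L with r , steps , clean ← reduce σ (λ p → ∃[ i ] p ≡ monomial i)
                       (λ i → yes (monomial i , (i , refl) , Lead-monomial i)) f =
    r , Star.map (λ { {f} (_ , i , (j , refl) , Lp , fi , refl) → monomial-step f i j Lp fi }) steps ,
    λ { {h} _ _ (i , ri , _) → true≢false ri (clean (i , refl) (Lead-monomial i)) }
    where
    monomial-step : ∀ f i j → Lead σ (monomial j) i → lookup f i ≡ true → σ , L ⊢ f ⟶ (f +ˡ monomial j)
    monomial-step f i j Lp fi with refl ← Lead-unique σ i j Lp (Lead-monomial j) =
      division-step 1∈L Lead-1ˡ (·-identityʳ _) fi (term·Supp-1ˡ i)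

  -- Without `1ˡ` in `L` every divisor is led by a variable, the cofactor is 1 by degree, and the
  -- step subtracts the divisor itself.
  ⟶⇒Span : ∀ {L f f′} → ¬ 1ˡ ∈ L → σ , L ⊢ f ⟶ f′ → Span L (f +ˡ f′)
  ⟶⇒Span {L} {f} {f′} 1∉L step with IsLT⇒Lead σ {f = _,_⊢_⟶_.h step} (_,_⊢_⟶_.leading step) | _,_⊢_⟶_.occurs step
  ... | zero , refl , Lh | _ = ⊥-elim (1∉L (subst (_∈ L) (Lead-zero Lh) (_,_⊢_⟶_.divisor step)))
  ... | suc i , refl , Lh | k , fk , eq with refl , _ ← ·-term-suc (_,_⊢_⟶_.t step) i k (sym eq) =
    subst (Span L) (sym (trans (cong (f +ˡ_) f′≡f+h) (+ˡ-cancelˡ f _))) (∈⇒Span (_,_⊢_⟶_.divisor step))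
    where
    open _,_⊢_⟶_ step using (h)
    f′≡f+h : f′ ≡ f +ˡ h
    f′≡f+h = Supp-ext {f = f′} {f +ˡ h} λ s →
      ⇔-sym (Supp-+ f h s) ⇔-∘ (xor-cong-⇔ (1·Supp h s) ⇔-∘ _,_⊢_⟶_.subtract step s)

  NR⇒Span : ∀ {L f r} → ¬ 1ˡ ∈ L → NR σ L f r → Span L (f +ˡ r)
  NR⇒Span {L} {f} {r} 1∉L (steps , _) = go steps
    where
    go : ∀ {f} → Star (σ , L ⊢_⟶_) f r → Span L (f +ˡ r)
    go {f} ε = subst (Span L) (sym (+ˡ-self f)) 0∈
    go {f} (_◅_ {j = f′} s ss) =
      subst (Span L) (trans (cong (_+ˡ (f′ +ˡ r)) (+ˡ-comm f f′)) (+ˡ-cancel-mid f′ f r))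
        (Span-+ (⟶⇒Span 1∉L s) (go ss))

  Clean-+ : ∀ {A : Pred (𝕃 n) 0ℓ} r s → Clean σ A r → Clean σ A s → Clean σ A (r +ˡ s)
  Clean-+ r s cr cs {i = i} Ap Lp = lookup-+-false {f = r} {s} {i} (cr Ap Lp) (cs Ap Lp)

  Clean-1ˡ : ∀ {L} → ¬ 1ˡ ∈ L → Clean σ (_∈ L) 1ˡ
  Clean-1ˡ 1∉L {i = zero}  h∈L Lh = ⊥-elim (1∉L (subst (_∈ _) (Lead-zero Lh) h∈L))
  Clean-1ˡ 1∉L {i = suc i} h∈L Lh = lookup-replicate i false

  -- The difference of two remainders is a clean element of the span, hence zero; with `1ˡ` in `L`
  -- both are zero.
  NR-unique : ∀ {L f r s} → DistinctLTs σ L → NR σ L f r → NR σ L f s → r ≡ s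
  NR-unique {L} {f} {r} {s} d p q with 1ˡ ∈? L
  ... | yes 1∈L = trans (NR-unit 1∈L p) (sym (NR-unit 1∈L q))
  ... | no 1∉L = +ˡ≡0⇒≡ (Clean-Span σ d
    (subst (Span L) (+ˡ-cancel-mid f r s) (Span-+ (NR⇒Span 1∉L p) (NR⇒Span 1∉L q)))
    (Clean-+ r s (Irreducible⇒Clean r (proj₂ p)) (Irreducible⇒Clean s (proj₂ q))))

  -- Again a clean element of the span vanishes; `r +ˡ 1ˡ` is clean because no element of `L` is led
  -- by 1. With `1ˡ` in `L` both remainders would be `0ˡ` and the equation would fail.
  NR-+1 : ∀ {L f r s} → DistinctLTs σ L → ¬ 1ˡ ∈ L → NR σ L f r → NR σ L (f +ˡ 1ˡ) s → s ≡ r +ˡ 1ˡ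
  NR-+1 {L} {f} {r} {s} d 1∉L p q = +ˡ≡0⇒≡ (Clean-Span σ d
    (subst (Span L) eq (Span-+ (NR⇒Span 1∉L p) (NR⇒Span 1∉L q)))
    (Clean-+ s (r +ˡ 1ˡ) (Irreducible⇒Clean s (proj₂ q)) (Clean-+ r 1ˡ (Irreducible⇒Clean r (proj₂ p)) (Clean-1ˡ 1∉L))))
    where
    eq : (f +ˡ r) +ˡ ((f +ˡ 1ˡ) +ˡ s) ≡ s +ˡ (r +ˡ 1ˡ)
    eq = trans (cong ((f +ˡ r) +ˡ_) (+ˡ-assoc f 1ˡ s)) (trans (+ˡ-cancel-mid f r _)
      (trans (sym (+ˡ-assoc r 1ˡ s)) (+ˡ-comm _ s)))

-- Ideals of 𝔹 n

module _ {n : ℕ} where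

  private module R = CommutativeRing (𝔹-ring n)

  scalar-xor : ∀ a b → scalar {n} (a xor b) ≈ scalar a ⊕ scalar b
  scalar-xor false b     = ≈-sym (⊕-identityˡ _)
  scalar-xor true  false = ≈-sym (R.+-identityʳ _)
  scalar-xor true  true  = ≈-sym (⊕-self _)

  scalar-∧ : ∀ a b → scalar {n} (a ∧ b) ≈ scalar a ⊗ scalar b
  scalar-∧ false b = ≈-sym (R.zeroˡ _)
  scalar-∧ true  b = ≈-sym (⊗-identityˡ _)

  private
    -- With coefficients from 𝔽₂ the ring solver also proves identities that hold only in
    -- characteristic two.
    𝔽₂-embedding : CommutativeRing.rawRing Bool.xor-∧-commutativeRing
                   -Raw-AlmostCommutative⟶ fromCommutativeRing (𝔹-ring n)
    𝔽₂-embedding = record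
      { ⟦_⟧ = scalar ; +-homo = scalar-xor ; *-homo = scalar-∧ ; -‿homo = λ _ → ≈-refl
      ; 0-homo = ≈-refl ; 1-homo = ≈-refl }

    scalar-≟ : ∀ a b → Maybe (scalar {n} a ≈ scalar b)
    scalar-≟ a b with a Bool.≟ b
    ... | yes refl = just ≈-refl
    ... | no _     = nothing

  open Algebra.Solver.Ring _ _ 𝔽₂-embedding scalar-≟ using (solve; _:=_; _:+_; _:*_; con)

  -- Squaring is multiplicative, and additive in characteristic two, so idempotence spreads from the
  -- variables to all polynomials.
  ⊗-idem : (f : 𝔹 n) → f ⊗ f ≈ f
  ⊗-idem 0ᵇ      = R.zeroˡ 0ᵇ
  ⊗-idem 1ᵇ      = ⊗-identityˡ 1ᵇ
  ⊗-idem (x i)   = x-idem i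
  ⊗-idem (f ⊕ g) = ≈-trans
    (solve 2 (λ f g → (f :+ g) :* (f :+ g) := (f :* f) :+ (g :* g)) ≈-refl f g)
    (⊕-cong (⊗-idem f) (⊗-idem g))
  ⊗-idem (f ⊗ g) = ≈-trans
    (solve 2 (λ f g → (f :* g) :* (f :* g) := (f :* f) :* (g :* g)) ≈-refl f g)
    (⊗-cong (⊗-idem f) (⊗-idem g))

  private
    module Σ = MonoidSum (CommutativeRing.+-monoid (𝔹-ring n))
    module Σᶜ = CommutativeMonoidSum (CommutativeRing.+-commutativeMonoid (𝔹-ring n))

  ι-+ : (f g : 𝕃 n) → ι (f +ˡ g) ≈ ι f ⊕ ι g
  ι-+ f g = ≈-trans
    (Σ.sum-cong-≋ λ i → ≈-trans
      (⊗-cong (≈-trans (R.reflexive (cong scalar (lookup-+ f g i))) (scalar-xor (lookup f i) (lookup g i))) ≈-refl)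
      (R.distribʳ (basis i) (scalar (lookup f i)) (scalar (lookup g i))))
    (Σᶜ.∑-distrib-+ (λ i → scalar (lookup f i) ⊗ basis i) (λ i → scalar (lookup g i) ⊗ basis i))

  ∑-zeros : ∀ {m} (c : Fin m → 𝔹 n) → Σ.sum (λ i → scalar (lookup (replicate m false) i) ⊗ c i) ≈ 0ᵇ
  ∑-zeros {m} c = ≈-trans
    (Σ.sum-cong-≋ λ i → ≈-trans (⊗-cong (R.reflexive (cong scalar (lookup-replicate i false))) ≈-refl) (R.zeroˡ (c i)))
    (Σ.sum-replicate-zero m)

  ι-0 : ι {n} 0ˡ ≈ 0ᵇ
  ι-0 = ∑-zeros basis

  ι-1 : ι {n} 1ˡ ≈ 1ᵇ
  ι-1 = ≈-trans (⊕-cong (⊗-identityˡ 1ᵇ) (∑-zeros (basis ∘ suc))) (R.+-identityʳ 1ᵇ)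

  ι-+1 : (f : 𝕃 n) → ι (f +ˡ 1ˡ) ≈ ι f ⊕ 1ᵇ
  ι-+1 f = ≈-trans (ι-+ f 1ˡ) (⊕-cong ≈-refl ι-1)

  module Ideal {K : Pred (𝔹 n) 0ℓ} (isIdeal : IsIdeal K) where

    private module K = IsIdeal isIdeal

    1∈⇒all : K 1ᵇ → ∀ f → K f
    1∈⇒all 1∈ f = K.resp (R.*-identityʳ f) (K.⊗-closed f 1∈)

    Span⇒ : ∀ {L} → (∀ {l} → l ∈ L → K (ι l)) → ∀ {f} → Span L f → K (ι f)
    Span⇒ L⊆K 0∈ = K.resp (≈-sym ι-0) K.0∈
    Span⇒ L⊆K (add {h} {f} h∈L p) = K.resp (≈-sym (ι-+ h f)) (K.⊕-closed (L⊆K h∈L) (Span⇒ L⊆K p))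

    infix 4 _⇒ᴷ_
    -- Modulo `K`, the vanishing of `f` entails that of `g`; so `0ˡ` plays the part of truth and
    -- `1ˡ` that of falsity. Being a record, the relation lets `f` and `g` be inferred, which the
    -- product of their images would not.
    record _⇒ᴷ_ (f g : 𝕃 n) : Set where
      constructor implies
      field product∈ : K (ι (f +ˡ 1ˡ) ⊗ ι g)
    open _⇒ᴷ_ public

    private
      fold : ∀ {f g} → K ((ι f ⊕ 1ᵇ) ⊗ ι g) → f ⇒ᴷ g
      fold {f} p = implies (K.resp (⊗-cong (≈-sym (ι-+1 f)) ≈-refl) p)

      unfold : ∀ {f g} → f ⇒ᴷ g → K ((ι f ⊕ 1ᵇ) ⊗ ι g)
      unfold {f} (implies p) = K.resp (⊗-cong (ι-+1 f) ≈-refl) p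

    ⇒ᴷ-refl : ∀ {f} → f ⇒ᴷ f
    ⇒ᴷ-refl {f} = fold (K.resp (≈-sym (≈-trans
      (solve 1 (λ a → (a :+ con true) :* a := (a :* a) :+ a) ≈-refl (ι f))
      (≈-trans (⊕-cong (⊗-idem (ι f)) ≈-refl) (⊕-self (ι f))))) K.0∈)

    -- The product of `f + 1` and `h` is split along `g` and `g + 1`.
    ⇒ᴷ-trans : ∀ {f g h} → f ⇒ᴷ g → g ⇒ᴷ h → f ⇒ᴷ h
    ⇒ᴷ-trans {f} {g} {h} p q = fold (K.resp
      (solve 3 (λ a b c → (c :* ((a :+ con true) :* b)) :+ ((a :+ con true) :* ((b :+ con true) :* c))
                          := (a :+ con true) :* c) ≈-refl (ι f) (ι g) (ι h))
      (K.⊕-closed (K.⊗-closed (ι h) (unfold p)) (K.⊗-closed (ι f ⊕ 1ᵇ) (unfold q))))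

    ⇒ᴷ-antisym : ∀ {f g} → f ⇒ᴷ g → g ⇒ᴷ f → K (ι (f +ˡ g))
    ⇒ᴷ-antisym {f} {g} p q = K.resp
      (≈-trans (solve 2 (λ a b → ((a :+ con true) :* b) :+ ((b :+ con true) :* a) := a :+ b) ≈-refl (ι f) (ι g))
               (≈-sym (ι-+ f g)))
      (K.⊕-closed (unfold p) (unfold q))

    ⇒ᴷ-cong : ∀ {f f′ g g′} → K (ι (f +ˡ f′)) → K (ι (g +ˡ g′)) → f ⇒ᴷ g → f′ ⇒ᴷ g′
    ⇒ᴷ-cong {f} {f′} {g} {g′} p q r = fold (K.resp
      (solve 4 (λ a a′ b b′ → ((a :+ con true) :* b) :+ ((b :* (a :+ a′)) :+ ((a′ :+ con true) :* (b :+ b′)))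
                              := (a′ :+ con true) :* b′) ≈-refl (ι f) (ι f′) (ι g) (ι g′))
      (K.⊕-closed (unfold r)
        (K.⊕-closed (K.⊗-closed (ι g) (K.resp (ι-+ f f′) p)) (K.⊗-closed (ι f′ ⊕ 1ᵇ) (K.resp (ι-+ g g′) q)))))

    0⇒ᴷ : ∀ {g} → 0ˡ ⇒ᴷ g → K (ι g)
    0⇒ᴷ {g} p = K.resp (≈-trans (⊗-cong (⊕-cong ι-0 ≈-refl) ≈-refl)
      (solve 1 (λ b → (con false :+ con true) :* b := b) ≈-refl (ι g))) (unfold p)

    ⇒ᴷ1 : ∀ {f} → f ⇒ᴷ 1ˡ → K (ι (f +ˡ 1ˡ))
    ⇒ᴷ1 {f} (implies p) = K.resp (≈-trans (⊗-cong ≈-refl ι-1) (R.*-identityʳ _)) p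

    K⇒ᴷ : ∀ {f g} → K (ι g) → f ⇒ᴷ g
    K⇒ᴷ {f} p = implies (K.⊗-closed (ι (f +ˡ 1ˡ)) p)

    ⇒ᴷK : ∀ {f g} → K (ι (f +ˡ 1ˡ)) → f ⇒ᴷ g
    ⇒ᴷK {f} {g} p = implies (K.resp (⊗-comm (ι g) (ι (f +ˡ 1ˡ))) (K.⊗-closed (ι g) p))

    NR-cong : ∀ {σ : TermOrdering n} {L f r} → (∀ {l} → l ∈ L → K (ι l)) → NR σ L f r → K (ι (f +ˡ r))
    NR-cong {σ} {L} {f} {r} L⊆K nr with _∈?_ σ 1ˡ L
    -- Here `f +ˡ r` need not lie in the span of `L`, but the ideal contains 1 and therefore
    -- everything.
    ... | yes 1∈L = 1∈⇒all (K.resp ι-1 (L⊆K 1∈L)) (ι (f +ˡ r))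
    ... | no 1∉L = Span⇒ L⊆K (NR⇒Span σ 1∉L nr)

  Generators : List (𝕃 n) → Pred (𝔹 n) 0ℓ
  Generators L p = Σ[ f ∈ 𝕃 n ] (f ∈ L × p ≈ ι f)

  Products : List (Edge n) → Pred (𝔹 n) 0ℓ
  Products E p = Σ[ f ∈ 𝕃 n ] Σ[ g ∈ 𝕃 n ] ((f +ˡ 1ˡ , g) ∈ E × p ≈ ι f ⊗ ι g)

  𝒥 : List (𝕃 n) → List (Edge n) → Pred (𝔹 n) 0ℓ
  𝒥 L E = ⟨ Generators L ⟩ +ⁱ ⟨ Products E ⟩

  𝒥-isIdeal : ∀ L E → IsIdeal (𝒥 L E)
  𝒥-isIdeal L E = record
    { resp = λ { eq (g , h , p , q , eq′) → g , h , p , q , ≈-trans (≈-sym eq) eq′ }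
    ; 0∈ = 0ᵇ , 0ᵇ , 0∈ , 0∈ , ≈-sym (⊕-self 0ᵇ)
    ; ⊕-closed = λ { (g , h , p , q , eq) (g′ , h′ , p′ , q′ , eq′) →
        g ⊕ g′ , h ⊕ h′ , ⊕-closed p p′ , ⊕-closed q q′ ,
        ≈-trans (⊕-cong eq eq′) (solve 4 (λ a b c d → (a :+ b) :+ (c :+ d) := (a :+ c) :+ (b :+ d)) ≈-refl g h g′ h′) }
    ; ⊗-closed = λ { f (g , h , p , q , eq) →
        f ⊗ g , f ⊗ h , ⊗-closed f p , ⊗-closed f q , ≈-trans (⊗-cong ≈-refl eq) (⊗-distribˡ f g h) }
    }

  𝒥-gen : ∀ {L E l} → l ∈ L → 𝒥 L E (ι l)
  𝒥-gen {l = l} l∈L = ι l , 0ᵇ , gen (l , l∈L , ≈-refl) , 0∈ , ≈-sym (R.+-identityʳ (ι l))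

  -- `Products` is indexed by the edge `(f +ˡ 1ˡ , g)`; adding `1ˡ` twice turns this into a
  -- statement about the edge `(f , g)`.
  𝒥-edge : ∀ {L E f g} → (f , g) ∈ E → 𝒥 L E (ι (f +ˡ 1ˡ) ⊗ ι g)
  𝒥-edge {E = E} {f} {g} e∈E = 0ᵇ , ι (f +ˡ 1ˡ) ⊗ ι g , 0∈ ,
    gen (f +ˡ 1ˡ , g , subst (λ h → (h , g) ∈ E) (sym (+ˡ-cancelʳ f 1ˡ)) e∈E , ≈-refl) , ≈-sym (⊕-identityˡ _)

  𝒥-least : ∀ {K L E} → IsIdeal K → (∀ {l} → l ∈ L → K (ι l)) →
            (∀ {f g} → (f , g) ∈ E → K (ι (f +ˡ 1ˡ) ⊗ ι g)) → 𝒥 L E ⊆ᵖ K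
  𝒥-least {K} {L} {E} isIdeal L⊆K E⊆K (g , h , p , q , eq) =
    K.resp (≈-sym eq) (K.⊕-closed (⟨⟩⊆ (λ { (_ , l∈L , eq) → K.resp (≈-sym eq) (L⊆K l∈L) }) p) (⟨⟩⊆ edges q))
    where
    module K = IsIdeal isIdeal
    ⟨⟩⊆ : ∀ {S} → S ⊆ᵖ K → ⟨ S ⟩ ⊆ᵖ K
    ⟨⟩⊆ S⊆K (gen s)        = S⊆K s
    ⟨⟩⊆ S⊆K (resp eq p)    = K.resp eq (⟨⟩⊆ S⊆K p)
    ⟨⟩⊆ S⊆K 0∈             = K.0∈
    ⟨⟩⊆ S⊆K (⊕-closed p q) = K.⊕-closed (⟨⟩⊆ S⊆K p) (⟨⟩⊆ S⊆K q)
    ⟨⟩⊆ S⊆K (⊗-closed f p) = K.⊗-closed f (⟨⟩⊆ S⊆K p)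
    edges : Products E ⊆ᵖ K
    edges (f , g , e∈E , eq) =
      K.resp (≈-trans (⊗-cong (R.reflexive (cong ι (+ˡ-cancelʳ f 1ˡ))) ≈-refl) (≈-sym eq)) (E⊆K e∈E)

-- Strongly connected components

AllPairs-map-∈ : ∀ {A : Set} {R S : Rel A 0ℓ} {as} → (∀ {a b} → a ∈ as → b ∈ as → R a b → S a b) →
                 AllPairs R as → AllPairs S as
AllPairs-map-∈ f []       = []
AllPairs-map-∈ f (r ∷ rs) = All.tabulate (λ b∈ → f (here refl) (there b∈) (All.lookup r b∈))
                          ∷ AllPairs-map-∈ (λ a∈ b∈ → f (there a∈) (there b∈)) rs

module _ {n : ℕ} where

  -- A path through the newest edge can be shortened to use it once: the older edges suffice before
  -- its first and after its last use. This gives a recursion on the edge list.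
  reach? : ∀ (E : List (Edge n)) f g → Dec (Star (E ∋_↦_) f g)
  reach? [] f g with f ≟ g
  ... | yes refl = yes ε
  ... | no f≢g   = no λ { ε → f≢g refl }
  reach? ((a , b) ∷ E) f g = map′ join split (reach? E f g ⊎-dec (reach? E f a ×-dec reach? E b g))
    where
    lift : ∀ {f g} → Star (E ∋_↦_) f g → Star (((a , b) ∷ E) ∋_↦_) f g
    lift ε        = ε
    lift (e ◅ es) = there e ◅ lift es
    join : ∀ {f g} → Star (E ∋_↦_) f g ⊎ (Star (E ∋_↦_) f a × Star (E ∋_↦_) b g) → Star (((a , b) ∷ E) ∋_↦_) f g
    join (inj₁ p)       = lift p
    join (inj₂ (p , q)) = lift p ◅◅ here refl ◅ lift q
    split : ∀ {f g} → Star (((a , b) ∷ E) ∋_↦_) f g →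
            Star (E ∋_↦_) f g ⊎ (Star (E ∋_↦_) f a × Star (E ∋_↦_) b g)
    split ε = inj₁ ε
    split (here refl ◅ p) with split p
    ... | inj₁ q       = inj₂ (ε , q)
    ... | inj₂ (_ , q) = inj₂ (ε , q)
    split (there e ◅ p) with split p
    ... | inj₁ q        = inj₁ (e ◅ q)
    ... | inj₂ (q , q′) = inj₂ (e ◅ q , q′)

  module Components (G : Tuple n) where

    open Tuple G

    infix 4 _~_
    _~_ : Rel (𝕃 n) 0ℓ
    f ~ g = Star (E ∋_↦_) f g × Star (E ∋_↦_) g f

    _~?_ : ∀ f g → Dec (f ~ g)
    f ~? g = reach? E f g ×-dec reach? E g f

    ~-trans : ∀ {f g h} → f ~ g → g ~ h → f ~ h
    ~-trans (p , p′) (q , q′) = p ◅◅ q , q′ ◅◅ p′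

    ~-decSetoid : DecSetoid 0ℓ 0ℓ
    ~-decSetoid = record
      { Carrier = 𝕃 n ; _≈_ = _~_
      ; isDecEquivalence = record
        { isEquivalence = record { refl = ε , ε ; sym = swap ; trans = ~-trans } ; _≟_ = _~?_ } }

    -- Adjoining to `S` a vertex that is mutually reachable with `f` keeps it strongly connected, so
    -- by maximality the vertex was there already.
    SCC-∈⇔ : ∀ {S f g} → IsSCC G S → f ∈ S → g ∈ S ⇔ (g ∈ V × f ~ g)
    SCC-∈⇔ {S} {f} {g} scc f∈S = mk⇔
      (λ g∈S → subset g∈S , paths f∈S g∈S , paths g∈S f∈S)
      (λ (g∈V , f~g) → maximal (enlarged g∈V f~g) there (here refl))
      where
      open IsSCC scc
      open IsStronglyConnected connected
      enlarged : g ∈ V → f ~ g → IsStronglyConnected G (g ∷ S)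
      enlarged g∈V (f⇝g , g⇝f) = record
        { subset = λ { (here refl) → g∈V ; (there h∈S) → subset h∈S }
        ; paths = λ { (here refl) (here refl) → ε
                    ; (here refl) (there h∈S) → g⇝f ◅◅ paths f∈S h∈S
                    ; (there h∈S) (here refl) → paths h∈S f∈S ◅◅ f⇝g
                    ; (there h∈S) (there k∈S) → paths h∈S k∈S } }

    SCC-∼ : ∀ {S T f g} → IsSCC G S → IsSCC G T → f ∈ S → g ∈ T → f ~ g → S ∼[ set ] T
    SCC-∼ S T f∈S g∈T f~g = mk⇔
      (λ h∈S → let h∈V , f~h = Equivalence.to (SCC-∈⇔ S f∈S) h∈S in
               Equivalence.from (SCC-∈⇔ T g∈T) (h∈V , ~-trans (swap f~g) f~h))
      (λ h∈T → let h∈V , g~h = Equivalence.to (SCC-∈⇔ T g∈T) h∈T in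
               Equivalence.from (SCC-∈⇔ S f∈S) (h∈V , ~-trans f~g g~h))

    vertices : List (𝕃 n)
    vertices = deduplicate _≟_ V

    class : 𝕃 n → List (𝕃 n)
    class f = filter (f ~?_) vertices

    ∈-class⁺ : ∀ {f g} → g ∈ V → f ~ g → g ∈ class f
    ∈-class⁺ {f} g∈V = ∈-filter⁺ (f ~?_) (∈-deduplicate⁺ _≟_ g∈V)

    ∈-class⁻ : ∀ {f g} → g ∈ class f → g ∈ V × f ~ g
    ∈-class⁻ {f} g∈ = let g∈vs , f~g = ∈-filter⁻ (f ~?_) {xs = vertices} g∈ in ∈-deduplicate⁻ _≟_ V g∈vs , f~g

    class-isSCC : ∀ {f} → f ∈ V → IsSCC G (class f)
    class-isSCC {f} f∈V = record
      { unique    = Unique.filter⁺ (f ~?_) (UniqueDec.deduplicate-! _≟_ V)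
      ; nonempty  = λ eq → case-[] (subst (f ∈_) eq f∈class)
      ; connected = record
        { subset = λ g∈ → proj₁ (∈-class⁻ g∈)
        ; paths  = λ g∈ h∈ → proj₁ (~-trans (swap (proj₂ (∈-class⁻ g∈))) (proj₂ (∈-class⁻ h∈))) }
      ; maximal   = λ T-sc class⊆T g∈T → let open IsStronglyConnected T-sc in
          ∈-class⁺ (subset g∈T) (paths (class⊆T f∈class) g∈T , paths g∈T (class⊆T f∈class)) }
      where
      f∈class : f ∈ class f
      f∈class = ∈-class⁺ f∈V (ε , ε)
      case-[] : ¬ f ∈ []
      case-[] ()

    SCC-inhabited : ∀ {S} → IsSCC G S → ∃[ f ] f ∈ S
    SCC-inhabited {[]}    scc = ⊥-elim (IsSCC.nonempty scc refl)
    SCC-inhabited {f ∷ _} scc = f , here refl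

    -- The value at `[]` is arbitrary, as components are nonempty.
    pick : List (𝕃 n) → 𝕃 n
    pick []      = 0ˡ
    pick (f ∷ _) = f

    representatives : List (𝕃 n)
    representatives = deduplicate _~?_ V

    SCCs : List (List (𝕃 n))
    SCCs = map class representatives

    SCCs-complete : AreAllSCCs G SCCs
    SCCs-complete = record
      { sound    = All.map⁺ (All.tabulate (class-isSCC ∘ rep⊆V))
      ; complete = complete
      ; distinct = AllPairs.map⁺ (AllPairs-map-∈ different (UniqueDecₛ.deduplicate-! ~-decSetoid V)) }
      where
      rep⊆V : ∀ {f} → f ∈ representatives → f ∈ V
      rep⊆V = ∈-deduplicate⁻ _~?_ V

      different : ∀ {f g} → f ∈ representatives → g ∈ representatives → ¬ f ~ g → ¬ class f ∼[ set ] class g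
      different f∈ g∈ f≁g eq = f≁g (swap (proj₂ (∈-class⁻ (Equivalence.to eq (∈-class⁺ (rep⊆V f∈) (ε , ε))))))

      complete : ∀ {S} → IsSCC G S → Any (S ∼[ set ]_) SCCs
      complete scc with f , f∈S ← SCC-inhabited scc
        with r , r∈ , f~r ← find (Membershipₛ.∈-deduplicate⁺ (DecSetoid.setoid ~-decSetoid) _~?_
               (λ p q → ~-trans q (swap p))
               (Any.map (λ { refl → ε , ε }) (IsStronglyConnected.subset (IsSCC.connected scc) f∈S)))
        = lose (∈-map⁺ class r∈) (SCC-∼ scc (class-isSCC (rep⊆V r∈)) f∈S (∈-class⁺ (rep⊆V r∈) (ε , ε)) f~r)

    starSums⁻ : ∀ {S l} → IsSCC G S → l ∈ starSums S → ∃[ f ] ∃[ g ] (f ∈ S × g ∈ S × f ≢ g × l ≡ f +ˡ g)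
    starSums⁻ {f ∷ S} scc l∈ with g , g∈ , refl ← ∈-map⁻ (f +ˡ_) l∈ with f∉S ∷ _ ← IsSCC.unique scc =
      f , g , here refl , there g∈ , All.lookup f∉S g∈ , refl

    module _ {𝒞 : List (List (𝕃 n))} (all : AreAllSCCs G 𝒞) where

      open AreAllSCCs all

      covering : ∀ {f} → f ∈ V → ∃[ S ] (S ∈ 𝒞 × IsSCC G S × f ∈ S)
      covering f∈V with S , S∈ , eq ← find (complete (class-isSCC f∈V)) =
        S , S∈ , All.lookup sound S∈ , Equivalence.to eq (∈-class⁺ f∈V (ε , ε))

      concat-starSums⁻ : ∀ {l} → l ∈ concatMap starSums 𝒞 →
        ∃[ f ] ∃[ g ] (f ∈ V × g ∈ V × f ~ g × f ≢ g × l ≡ f +ˡ g)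
      concat-starSums⁻ l∈ with _ , l∈S , S∈ ← ∈-concat⁻′ (map starSums 𝒞) l∈
        with S , S∈𝒞 , refl ← ∈-map⁻ starSums S∈
        with f , g , f∈S , g∈S , f≢g , eq ← starSums⁻ (All.lookup sound S∈𝒞) l∈S =
        let open IsStronglyConnected (IsSCC.connected (All.lookup sound S∈𝒞)) in
        f , g , subset f∈S , subset g∈S , (paths f∈S g∈S , paths g∈S f∈S) , f≢g , eq

      -- The rest of a cycle leads back from the end of its first edge to the start, so both ends
      -- share a component. Without sums it has one element, but no edge is a loop.
      starSums≡[]⇒acyclic : concatMap starSums 𝒞 ≡ [] →
        (∀ {f g} → (f , g) ∈ E → f ∈ V × g ∈ V × f ≢ g) → IsAcyclic G
      starSums≡[]⇒acyclic none edges f cycle = no-cycle cycle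
        where
        singleton : ∀ {S f g} → starSums S ≡ [] → f ∈ S → g ∈ S → f ≡ g
        singleton {_ ∷ []} _ (here refl) (here refl) = refl
        no-sums : ∀ {S} → S ∈ 𝒞 → starSums S ≡ []
        no-sums {S} S∈𝒞 with starSums S in eq
        ... | []    = refl
        ... | l ∷ _ with () ← subst (l ∈_) none (∈-concat⁺′ (subst (l ∈_) (sym eq) (here refl)) (∈-map⁺ starSums S∈𝒞))
        back : ∀ {f g} → TransClosure (E ∋_↦_) f g → Star (E ∋_↦_) f g
        back [ e ]    = e ◅ ε
        back (e ∷ es) = e ◅ back es
        no-cycle : ¬ TransClosure (E ∋_↦_) f f
        no-cycle [ e ] = proj₂ (proj₂ (edges e)) refl
        no-cycle (e ∷ es) with f∈V , g∈V , f≢g ← edges e with S , S∈ , scc , f∈S ← covering f∈V =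
          f≢g (singleton (no-sums S∈) f∈S (Equivalence.from (SCC-∈⇔ scc f∈S) (g∈V , e ◅ ε , back es)))

      -- The parity count uses one picked vertex per component. Adding `1ˡ` need not map picks to
      -- picks, so it is treated as an involution up to `~`, and a fixed class is exactly what is
      -- sought.
      odd⇒f~f+1 : (∀ {f g} → (f , g) ∈ E → (g +ˡ 1ˡ , f +ˡ 1ˡ) ∈ E) → (∀ {f} → f ∈ V → f +ˡ 1ˡ ∈ V) →
                          ¬ 2 ∣ length 𝒞 → ∃[ f ] f ~ f +ˡ 1ˡ
      odd⇒f~f+1 skew V+1 ¬even with Any.any? (λ f → f ~? (f +ˡ 1ˡ)) (map pick 𝒞)
      ... | yes p = Any.satisfied p
      ... | no ∄f = ⊥-elim (¬even (subst (2 ∣_) (length-map pick 𝒞)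
        (involution⇒even _~_ swap ~-trans (_+ˡ 1ˡ) ~-+1 (λ f → +ˡ-cancelʳ f 1ˡ)
          distinct-picks (λ f∈ f~ → ∄f (lose f∈ f~)) partner)))
        where
        pick∈ : ∀ {S} → S ∈ 𝒞 → pick S ∈ S
        pick∈ {[]}    S∈ = ⊥-elim (IsSCC.nonempty (All.lookup sound S∈) refl)
        pick∈ {f ∷ S} S∈ = here refl
        -- Skew-symmetry is contraposition, so paths are reversed.
        path-+1 : ∀ {f g} → Star (E ∋_↦_) f g → Star (E ∋_↦_) (g +ˡ 1ˡ) (f +ˡ 1ˡ)
        path-+1 ε        = ε
        path-+1 (e ◅ es) = path-+1 es ◅◅ skew e ◅ ε
        ~-+1 : ∀ {f g} → f ~ g → f +ˡ 1ˡ ~ g +ˡ 1ˡ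
        ~-+1 (p , q) = path-+1 q , path-+1 p
        distinct-picks : AllPairs (λ f g → ¬ f ~ g) (map pick 𝒞)
        distinct-picks = AllPairs.map⁺ (AllPairs-map-∈
          (λ S∈ T∈ S≁T f~g → S≁T (SCC-∼ (All.lookup sound S∈) (All.lookup sound T∈) (pick∈ S∈) (pick∈ T∈) f~g)) distinct)
        partner : ∀ {f} → f ∈ map pick 𝒞 → ∃[ g ] (g ∈ map pick 𝒞 × g ~ f +ˡ 1ˡ)
        partner f∈ with S , S∈ , refl ← ∈-map⁻ pick f∈
          with T , T∈ , scc , f+1∈T ← covering (V+1
                 (IsStronglyConnected.subset (IsSCC.connected (All.lookup sound S∈)) (pick∈ S∈))) =
          pick T , ∈-map⁺ pick T∈ , paths (pick∈ T∈) f+1∈T , paths f+1∈T (pick∈ T∈)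
          where open IsStronglyConnected (IsSCC.connected scc)

-- Runs of the procedures

-- The conditionals of `append` sit in its local definitions; these rules for an arbitrary decision
-- give access to them without unfolding any comparison.
if-∷⁻ : ∀ {A P : Set} (P? : Dec P) {a b : A} {as} → b ∈ (if does P? then a ∷ as else as) → b ∈ as ⊎ (P × b ≡ a)
if-∷⁻ (yes p) (here eq)  = inj₂ (p , eq)
if-∷⁻ (yes p) (there b∈) = inj₁ b∈
if-∷⁻ (no ¬p) b∈         = inj₁ b∈

if-∷⁺-old : ∀ {A P : Set} (P? : Dec P) {a b : A} {as} → b ∈ as → b ∈ (if does P? then a ∷ as else as)
if-∷⁺-old (yes p) = there
if-∷⁺-old (no ¬p) = id

if-∷⁺-new : ∀ {A P : Set} (P? : Dec P) {a : A} {as} → P → a ∈ (if does P? then a ∷ as else as)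
if-∷⁺-new (yes _) p = here refl
if-∷⁺-new (no ¬p) p = ⊥-elim (¬p p)

if-cases : ∀ {A P : Set} (P? : Dec P) (a b : A) →
           (P × (if does P? then a else b) ≡ a) ⊎ (¬ P × (if does P? then a else b) ≡ b)
if-cases (yes p) a b = inj₁ (p , refl)
if-cases (no ¬p) a b = inj₂ (¬p , refl)

module _ {n : ℕ} where

  Nonconstant : 𝕃 n → Set
  Nonconstant f = f ≢ 0ˡ × f ≢ 1ˡ

  Nonconstant-+1 : ∀ {f} → Nonconstant f → Nonconstant (f +ˡ 1ˡ)
  Nonconstant-+1 {f} (f≢0 , f≢1) =
    (λ eq → f≢1 (+ˡ≡0⇒≡ eq)) , λ eq → f≢0 (trans (sym (+ˡ-swap (sym eq))) (+ˡ-self 1ˡ))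

  +1-injective : ∀ {f g : 𝕃 n} → f +ˡ 1ˡ ≡ g +ˡ 1ˡ → f ≡ g
  +1-injective {f} {g} eq = trans (sym (+ˡ-cancelʳ f 1ˡ)) (trans (cong (_+ˡ 1ˡ) eq) (+ˡ-cancelʳ g 1ˡ))

  -- Unit propagation along an implication from `a` to `b`: a true premise makes the conclusion
  -- vanish, a false conclusion refutes the premise.
  Forced : 𝕃 n → 𝕃 n → 𝕃 n → Set
  Forced a b l = (a ≡ 0ˡ × b ≢ 0ˡ × l ≡ b) ⊎ (b ≡ 1ˡ × a ≢ 1ˡ × l ≡ a +ˡ 1ˡ)

  Kept : 𝕃 n → 𝕃 n → Set
  Kept a b = Nonconstant a × Nonconstant b × a ≢ b

  kept? : ∀ a b → Dec (Kept a b)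
  kept? a b = (¬? (a ≟ 0ˡ) ×-dec ¬? (a ≟ 1ˡ)) ×-dec (¬? (b ≟ 0ˡ) ×-dec ¬? (b ≟ 1ˡ)) ×-dec ¬? (a ≟ b)

  -- Specifies `append` by membership alone, which is all that matters for lists standing for sets
  -- and spares later proofs the nested conditionals.
  record Appended (a b : 𝕃 n) (G G⁺ : Tuple n) : Set where
    open Tuple G
    open Tuple G⁺ renaming (L to L⁺; V to V⁺; E to E⁺)
    field
      L-new  : ∀ {l} → Forced a b l → l ∈ L⁺
      L-old  : ∀ {l} → l ∈ L → l ∈ L⁺
      L-only : ∀ {l} → l ∈ L⁺ → l ∈ L ⊎ Forced a b l
      E-new  : Kept a b → (a , b) ∈ E⁺
      E-old  : ∀ {e} → e ∈ E → e ∈ E⁺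
      E-only : ∀ {e} → e ∈ E⁺ → e ∈ E ⊎ (Kept a b × e ≡ (a , b))
      V-new  : Kept a b → a ∈ V⁺ × b ∈ V⁺
      V-old  : ∀ {v} → v ∈ V → v ∈ V⁺
      V-only : ∀ {v} → v ∈ V⁺ → v ∈ V ⊎ (Kept a b × (v ≡ a ⊎ v ≡ b))

  append-appended : ∀ a b G → Appended a b G (append a b G)
  append-appended a b G@(⟪ L , V , E ⟫)
    with if-cases (kept? a b) (a ∷ b ∷ V , (a , b) ∷ E) (V , E)
  ... | VE = record
    { L-new  = λ { (inj₁ (a≡0 , b≢0 , refl)) → if-∷⁺-old forced₁? (if-∷⁺-new forced₀? (a≡0 , b≢0))
                 ; (inj₂ (b≡1 , a≢1 , refl)) → if-∷⁺-new forced₁? (b≡1 , a≢1) }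
    ; L-old  = if-∷⁺-old forced₁? ∘ if-∷⁺-old forced₀?
    ; L-only = L-only
    ; E-new  = λ k → E-new k VE
    ; E-old  = E-old VE
    ; E-only = E-only VE
    ; V-new  = λ k → V-new k VE
    ; V-old  = V-old VE
    ; V-only = V-only VE
    }
    where
    forced₀? : Dec (a ≡ 0ˡ × b ≢ 0ˡ)
    forced₀? = (a ≟ 0ˡ) ×-dec ¬? (b ≟ 0ˡ)
    forced₁? : Dec (b ≡ 1ˡ × a ≢ 1ˡ)
    forced₁? = (b ≟ 1ˡ) ×-dec ¬? (a ≟ 1ˡ)
    V⁺ = Tuple.V (append a b G)
    E⁺ = Tuple.E (append a b G)
    Split = (Kept a b × (V⁺ , E⁺) ≡ (a ∷ b ∷ V , (a , b) ∷ E)) ⊎ (¬ Kept a b × (V⁺ , E⁺) ≡ (V , E))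

    L-only : ∀ {l} → l ∈ Tuple.L (append a b G) → l ∈ L ⊎ Forced a b l
    L-only l∈ with if-∷⁻ forced₁? l∈
    ... | inj₂ ((b≡1 , a≢1) , eq) = inj₂ (inj₂ (b≡1 , a≢1 , eq))
    ... | inj₁ l∈₁ with if-∷⁻ forced₀? l∈₁
    ...   | inj₂ ((a≡0 , b≢0) , eq) = inj₂ (inj₁ (a≡0 , b≢0 , eq))
    ...   | inj₁ l∈L = inj₁ l∈L
    E-new : Kept a b → Split → (a , b) ∈ E⁺
    E-new k (inj₁ (_ , eq)) = subst (_ ∈_) (sym (cong proj₂ eq)) (here refl)
    E-new k (inj₂ (¬k , _)) = ⊥-elim (¬k k)
    E-old : Split → ∀ {e} → e ∈ E → e ∈ E⁺
    E-old (inj₁ (_ , eq)) e∈ = subst (_ ∈_) (sym (cong proj₂ eq)) (there e∈)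
    E-old (inj₂ (_ , eq)) e∈ = subst (_ ∈_) (sym (cong proj₂ eq)) e∈
    E-only : Split → ∀ {e} → e ∈ E⁺ → e ∈ E ⊎ (Kept a b × e ≡ (a , b))
    E-only (inj₂ (_ , eq)) e∈ = inj₁ (subst (_ ∈_) (cong proj₂ eq) e∈)
    E-only (inj₁ (k , eq)) e∈ with subst (_ ∈_) (cong proj₂ eq) e∈
    ... | here refl = inj₂ (k , refl)
    ... | there e∈E = inj₁ e∈E
    V-new : Kept a b → Split → a ∈ V⁺ × b ∈ V⁺
    V-new k (inj₁ (_ , eq)) = subst (_ ∈_) (sym (cong proj₁ eq)) (here refl) ,
                              subst (_ ∈_) (sym (cong proj₁ eq)) (there (here refl))
    V-new k (inj₂ (¬k , _)) = ⊥-elim (¬k k)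
    V-old : Split → ∀ {v} → v ∈ V → v ∈ V⁺
    V-old (inj₁ (_ , eq)) v∈ = subst (_ ∈_) (sym (cong proj₁ eq)) (there (there v∈))
    V-old (inj₂ (_ , eq)) v∈ = subst (_ ∈_) (sym (cong proj₁ eq)) v∈
    V-only : Split → ∀ {v} → v ∈ V⁺ → v ∈ V ⊎ (Kept a b × (v ≡ a ⊎ v ≡ b))
    V-only (inj₂ (_ , eq)) v∈ = inj₁ (subst (_ ∈_) (cong proj₁ eq) v∈)
    V-only (inj₁ (k , eq)) v∈ with subst (_ ∈_) (cong proj₁ eq) v∈
    ... | here refl         = inj₂ (k , inj₁ refl)
    ... | there (here refl) = inj₂ (k , inj₂ refl)
    ... | there (there v∈V) = inj₁ v∈V

  skew-edge : ∀ {I} {G : Tuple n} → IsIGS I G → ∀ {f g} → (f , g) ∈ Tuple.E G → (g +ˡ 1ˡ , f +ˡ 1ˡ) ∈ Tuple.E G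
  skew-edge igs {f} {g} e∈E = IsIGS.skew-symmetric igs (subst (λ h → (h , g) ∈ _) (sym (+ˡ-cancelʳ f 1ˡ)) e∈E)

  -- The graph stays the same, so only the two ideals have to be compared. It serves both the
  -- interreduction and the adjunction of sums from components.
  IGS-replace-L : ∀ {I} {L M V : List (𝕃 n)} {E} → IsIGS I ⟪ L , V , E ⟫ →
    (∀ {l} → l ∈ L → 𝒥 M E (ι l)) → (∀ {l} → l ∈ M → 𝒥 L E (ι l)) → IsIGS I ⟪ M , V , E ⟫
  IGS-replace-L {L = L} {M} {E = E} igs L⊆ M⊆ = record
    { edges⊆V² = edges⊆V² ; skew-symmetric = skew-symmetric ; irreflexive = irreflexive
    ; ideal = 𝒥-least (𝒥-isIdeal M E) L⊆ 𝒥-edge ∘ proj₁ ideal , proj₂ ideal ∘ 𝒥-least (𝒥-isIdeal L E) M⊆ 𝒥-edge }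
    where open IsIGS igs

  path⇒ : ∀ {L E} {f g : 𝕃 n} → Star (E ∋_↦_) f g → Ideal._⇒ᴷ_ (𝒥-isIdeal L E) f g
  path⇒ {L} {E} ε        = Ideal.⇒ᴷ-refl (𝒥-isIdeal L E)
  path⇒ {L} {E} (e ◅ es) = Ideal.⇒ᴷ-trans (𝒥-isIdeal L E) (Ideal.implies (𝒥-edge e)) (path⇒ es)

  𝒥-cycle : ∀ {L E} {f g : 𝕃 n} → Star (E ∋_↦_) f g → Star (E ∋_↦_) g f → 𝒥 L E (ι (f +ˡ g))
  𝒥-cycle {L} {E} p q = Ideal.⇒ᴷ-antisym (𝒥-isIdeal L E) (path⇒ p) (path⇒ q)

-- The tuple built by one pass of the loop.

module _ {n : ℕ} (σ : TermOrdering n) where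

  -- the loop of GGCP after the edges in done have been visited
  record Pass (L : List (𝕃 n)) (done : List (Edge n)) (G′ : Tuple n) : Set where
    open Tuple G′ renaming (L to L′; V to V′; E to E′)
    field
      L⊆L′      : ∀ {l} → l ∈ L → l ∈ L′
      forced⁻   : ∀ {l} → l ∈ L′ → l ∈ L ⊎ (∃[ f ] ∃[ g ] ∃[ a ] ∃[ b ]
                    ((f , g) ∈ done × NR σ L f a × NR σ L g b × Forced a b l))
      edge⁻     : ∀ {a b} → (a , b) ∈ E′ → Kept a b × (∃[ f ] ∃[ g ] ((f , g) ∈ done × NR σ L f a × NR σ L g b))
      endpoints : ∀ {a b} → (a , b) ∈ E′ → a ∈ V′ × b ∈ V′
      vertex⁻   : ∀ {v} → v ∈ V′ → ∃[ w ] ((v , w) ∈ E′ ⊎ (w , v) ∈ E′)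
      visited   : ∀ {f g} → (f , g) ∈ done → ∃[ a ] ∃[ b ] (NR σ L f a × NR σ L g b ×
                    (∀ {l} → Forced a b l → l ∈ L′) × (Kept a b → (a , b) ∈ E′))

  Pass-start : ∀ {L} → Pass L [] ⟪ L , [] , [] ⟫
  Pass-start = record
    { L⊆L′ = id ; forced⁻ = inj₁ ; edge⁻ = λ () ; endpoints = λ () ; vertex⁻ = λ () ; visited = λ () }

  Pass-visit : ∀ {L done G G⁺ f g a b} → Pass L done G → NR σ L f a → NR σ L g b →
               Appended a b G G⁺ → Pass L ((f , g) ∷ done) G⁺
  Pass-visit {L} {done} {G} {G⁺} {f} {g} {a} {b} pass nf ng appended = record
    { L⊆L′      = A.L-old ∘ P.L⊆L′
    ; forced⁻   = forced⁻
    ; edge⁻     = edge⁻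
    ; endpoints = endpoints
    ; vertex⁻   = vertex⁻
    ; visited   = λ { (here refl) → a , b , nf , ng , A.L-new , A.E-new
                    ; (there e∈)  → let a′ , b′ , nf′ , ng′ , forced , kept = P.visited e∈ in
                        a′ , b′ , nf′ , ng′ , A.L-old ∘ forced , A.E-old ∘ kept }
    }
    where
    module P = Pass pass
    module A = Appended appended
    forced⁻ : ∀ {l} → l ∈ Tuple.L G⁺ → _
    forced⁻ l∈ with A.L-only l∈
    ... | inj₂ forced = inj₂ (f , g , a , b , here refl , nf , ng , forced)
    ... | inj₁ l∈G with P.forced⁻ l∈G
    ...   | inj₁ l∈L = inj₁ l∈L
    ...   | inj₂ (f′ , g′ , a′ , b′ , e∈ , rest) = inj₂ (f′ , g′ , a′ , b′ , there e∈ , rest)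
    edge⁻ : ∀ {a′ b′} → (a′ , b′) ∈ Tuple.E G⁺ → _
    edge⁻ e∈ with A.E-only e∈
    ... | inj₂ (kept , refl) = kept , f , g , here refl , nf , ng
    ... | inj₁ e∈G = let kept , f′ , g′ , e∈′ , rest = P.edge⁻ e∈G in kept , f′ , g′ , there e∈′ , rest
    endpoints : ∀ {a′ b′} → (a′ , b′) ∈ Tuple.E G⁺ → _
    endpoints e∈ with A.E-only e∈
    ... | inj₂ (kept , refl) = A.V-new kept
    ... | inj₁ e∈G = let p , q = P.endpoints e∈G in A.V-old p , A.V-old q
    vertex⁻ : ∀ {v} → v ∈ Tuple.V G⁺ → ∃[ w ] ((v , w) ∈ Tuple.E G⁺ ⊎ (w , v) ∈ Tuple.E G⁺)
    vertex⁻ v∈ with A.V-only v∈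
    ... | inj₂ (kept , inj₁ refl) = b , inj₁ (A.E-new kept)
    ... | inj₂ (kept , inj₂ refl) = a , inj₂ (A.E-new kept)
    ... | inj₁ v∈G with P.vertex⁻ v∈G
    ...   | w , inj₁ e∈ = w , inj₁ (A.E-old e∈)
    ...   | w , inj₂ e∈ = w , inj₂ (A.E-old e∈)

module _ {n : ℕ} (σ : TermOrdering n) where

  -- Supplies the assumption under which remainders commute with adding `1ˡ`.
  NR-nonzero⇒1∉ : ∀ {L f r} → NR σ L f r → r ≢ 0ˡ → ¬ 1ˡ ∈ L
  NR-nonzero⇒1∉ nr r≢0 1∈L = r≢0 (NR-unit σ 1∈L nr)

  module _ {L done G′} (pass : Pass σ L done G′) where

    open Pass pass
    open Tuple G′ renaming (L to L′; V to V′; E to E′)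

    Pass-forced : ∀ {l} → l ∈ L′ → ¬ l ∈ L → l ≢ 0ˡ × Clean σ (_∈ L) l
    Pass-forced l∈L′ l∉L with forced⁻ l∈L′
    ... | inj₁ l∈L = ⊥-elim (l∉L l∈L)
    ... | inj₂ (_ , _ , a , b , _ , na , nb , inj₁ (_ , b≢0 , refl)) = b≢0 , Irreducible⇒Clean σ b (proj₂ nb)
    -- The remainder `b` is `1ˡ`, so `1ˡ` is not in `L` and adding it to `a` keeps `a` clean.
    ... | inj₂ (_ , _ , a , b , _ , na , nb , inj₂ (refl , a≢1 , refl)) =
      a≢1 ∘ +ˡ≡0⇒≡ , Clean-+ σ a 1ˡ (Irreducible⇒Clean σ a (proj₂ na)) (Clean-1ˡ σ (NR-nonzero⇒1∉ nb (λ ())))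

    Pass-vertex : ∀ {v} → v ∈ V′ → ∃[ f ] ∃[ g ] ((f , g) ∈ done × (NR σ L f v ⊎ NR σ L g v))
    Pass-vertex v∈ with vertex⁻ v∈
    ... | _ , inj₁ e∈ = let _ , f , g , fg∈ , nf , _ = edge⁻ e∈ in f , g , fg∈ , inj₁ nf
    ... | _ , inj₂ e∈ = let _ , f , g , fg∈ , _ , ng = edge⁻ e∈ in f , g , fg∈ , inj₂ ng

    Pass-vertex-irreducible : ∀ {v} → v ∈ V′ → Irreducible σ L v
    Pass-vertex-irreducible v∈ with Pass-vertex v∈
    ... | _ , _ , _ , inj₁ nr = proj₂ nr
    ... | _ , _ , _ , inj₂ nr = proj₂ nr

  -- Two inclusions relate `done` to `E`, since visiting the edges reverses their order.
  module CompletePass {I L V E done G′} (igs : IsIGS I ⟪ L , V , E ⟫) (distinct : DistinctLTs σ L)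
                      (pass : Pass σ L done G′) (done⊆E : ∀ {e} → e ∈ done → e ∈ E)
                      (E⊆done : ∀ {e} → e ∈ E → e ∈ done) where

    open Pass pass
    open Tuple G′ renaming (L to L′; V to V′; E to E′)

    -- A kept edge stems from some `(u , v)` in `E`. The contraposed edge is in `E` too and was
    -- visited; by `NR-+1` its remainders are `g +ˡ 1ˡ` and `f +ˡ 1ˡ`, and the test for keeping an
    -- edge is invariant under this exchange.
    skew′ : ∀ {f g} → (f , g) ∈ E′ → (g +ˡ 1ˡ , f +ˡ 1ˡ) ∈ E′
    skew′ {f} {g} e∈ with (ncf@(f≢0 , _) , ncg , f≢g) , u , v , uv∈ , nu , nv ← edge⁻ e∈
      with a , b , na , nb , _ , kept ← visited (E⊆done (skew-edge igs (done⊆E uv∈)))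
      with refl ← NR-+1 σ distinct (NR-nonzero⇒1∉ nu f≢0) nv na
      with refl ← NR-+1 σ distinct (NR-nonzero⇒1∉ nu f≢0) nu nb =
      kept (Nonconstant-+1 ncg , Nonconstant-+1 ncf , λ eq → f≢g (sym (+1-injective eq)))

    vertex-+1 : ∀ {v} → v ∈ V′ → v +ˡ 1ˡ ∈ V′
    vertex-+1 v∈ with vertex⁻ v∈
    ... | _ , inj₁ e∈ = proj₂ (endpoints (skew′ e∈))
    ... | _ , inj₂ e∈ = proj₁ (endpoints (skew′ e∈))

    𝒥⊆𝒥′ : ∀ {p} → 𝒥 L E p → 𝒥 L′ E′ p
    𝒥⊆𝒥′ = 𝒥-least (𝒥-isIdeal L′ E′) L⊆ (product∈ ∘ edge)
      where
      open Ideal (𝒥-isIdeal L′ E′)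
      L⊆ : ∀ {l} → l ∈ L → 𝒥 L′ E′ (ι l)
      L⊆ = 𝒥-gen ∘ L⊆L′
      ι0∈ : 𝒥 L′ E′ (ι 0ˡ)
      ι0∈ = Span⇒ {L = L′} 𝒥-gen 0∈
      -- An edge that is not kept either holds trivially (equal ends, conclusion `0ˡ`, premise `1ˡ`)
      -- or has left its content in `L′`.
      remainders : ∀ {a b} → (∀ {l} → Forced a b l → l ∈ L′) → (Kept a b → (a , b) ∈ E′) → a ⇒ᴷ b
      remainders {a} {b} forced kept with a ≟ b
      ... | yes refl = ⇒ᴷ-refl
      ... | no a≢b with b ≟ 0ˡ
      ...   | yes refl = K⇒ᴷ ι0∈
      ...   | no b≢0 with a ≟ 1ˡ
      ...     | yes refl = ⇒ᴷK (subst (𝒥 L′ E′ ∘ ι) (sym (+ˡ-self 1ˡ)) ι0∈)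
      ...     | no a≢1 with a ≟ 0ˡ
      ...       | yes refl = K⇒ᴷ (𝒥-gen (forced (inj₁ (refl , b≢0 , refl))))
      ...       | no a≢0 with b ≟ 1ˡ
      ...         | yes refl = ⇒ᴷK (𝒥-gen (forced (inj₂ (refl , a≢1 , refl))))
      ...         | no b≢1 = implies (𝒥-edge (kept ((a≢0 , a≢1) , (b≢0 , b≢1) , a≢b)))
      edge : ∀ {f g} → (f , g) ∈ E → f ⇒ᴷ g
      edge {f} {g} e∈ with a , b , na , nb , forced , kept ← visited (E⊆done e∈) =
        ⇒ᴷ-cong (subst (𝒥 L′ E′ ∘ ι) (+ˡ-comm f a) (NR-cong L⊆ na))
                (subst (𝒥 L′ E′ ∘ ι) (+ˡ-comm g b) (NR-cong L⊆ nb))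
                (remainders forced kept)

    𝒥′⊆𝒥 : ∀ {p} → 𝒥 L′ E′ p → 𝒥 L E p
    𝒥′⊆𝒥 = 𝒥-least (𝒥-isIdeal L E) L′⊆ (product∈ ∘ edge)
      where
      open Ideal (𝒥-isIdeal L E)
      remainders : ∀ {f g a b} → (f , g) ∈ done → NR σ L f a → NR σ L g b → a ⇒ᴷ b
      remainders {f} {g} e∈ na nb = ⇒ᴷ-cong (NR-cong 𝒥-gen na) (NR-cong 𝒥-gen nb)
        (implies {f} {g} (𝒥-edge (done⊆E e∈)))
      L′⊆ : ∀ {l} → l ∈ L′ → 𝒥 L E (ι l)
      L′⊆ l∈ with forced⁻ l∈
      ... | inj₁ l∈L = 𝒥-gen l∈L
      ... | inj₂ (f , g , a , b , e∈ , na , nb , inj₁ (refl , _ , refl)) = 0⇒ᴷ (remainders e∈ na nb)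
      ... | inj₂ (f , g , a , b , e∈ , na , nb , inj₂ (refl , _ , refl)) = ⇒ᴷ1 (remainders e∈ na nb)
      edge : ∀ {a b} → (a , b) ∈ E′ → a ⇒ᴷ b
      edge e∈ with _ , f , g , fg∈ , na , nb ← edge⁻ e∈ = remainders fg∈ na nb

    isIGS : IsIGS I G′
    isIGS = record
      { edges⊆V² = endpoints
      ; ideal = 𝒥⊆𝒥′ ∘ proj₁ (IsIGS.ideal igs) , proj₂ (IsIGS.ideal igs) ∘ 𝒥′⊆𝒥
      ; skew-symmetric = λ {f} {g} e∈ → subst (λ h → (g +ˡ 1ˡ , h) ∈ E′) (+ˡ-cancelʳ f 1ˡ) (skew′ e∈)
      ; irreflexive = λ _ e∈ → proj₂ (proj₂ (proj₁ (edge⁻ e∈))) refl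
      }

    -- Every vertex of `V′` is the remainder of an end of an edge, hence of an element of `V`, and
    -- remainders are unique.
    decreases : G′ ⪯ ⟪ L , V , E ⟫
    decreases = Span-least (∈⇒Span ∘ L⊆L′) ,
      length-image-≤ (NR σ L) (NR-unique σ distinct) (UniqueDec.deduplicate-! _≟_ V′) (deduplicate _≟_ V) preimage
      where
      preimage : ∀ {v} → v ∈ deduplicate _≟_ V′ → ∃[ u ] (u ∈ deduplicate _≟_ V × NR σ L u v)
      preimage v∈ with Pass-vertex pass (∈-deduplicate⁻ _≟_ V′ v∈)
      ... | f , g , fg∈ , inj₁ nf = f , ∈-deduplicate⁺ _≟_ (proj₁ (IsIGS.edges⊆V² igs (done⊆E fg∈))) , nf
      ... | f , g , fg∈ , inj₂ ng = g , ∈-deduplicate⁺ _≟_ (proj₂ (IsIGS.edges⊆V² igs (done⊆E fg∈))) , ng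

    isReduced : L ∼[ set ] L′ → IsReduced σ G′
    isReduced eq =
      (proj₁ distinct ∘ Equivalence.from eq , λ f∈ g∈ →
        proj₂ distinct (Equivalence.from eq f∈) (Equivalence.from eq g∈)) ,
      λ {h} {f} h∈ v∈ lt ft →
        Pass-vertex-irreducible pass v∈ {t = 1ᵗ} (Equivalence.from eq h∈) lt
          (subst (Supp f) (sym (·-identityˡ _)) ft)

  -- In the negative case a bare refutation would not do: the element that tells the sets apart is
  -- the one that makes `codim` drop.
  _∼?_ : (L M : List (𝕃 n)) → (∃[ l ] ((l ∈ L × ¬ l ∈ M) ⊎ (l ∈ M × ¬ l ∈ L))) ⊎ L ∼[ set ] M
  L ∼? M with Any.any? (λ l → ¬? (_∈?_ σ l M)) L | Any.any? (λ l → ¬? (_∈?_ σ l L)) M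
  ... | yes p | _     = let l , l∈L , l∉M = find p in inj₁ (l , inj₁ (l∈L , l∉M))
  ... | no _  | yes p = let l , l∈M , l∉L = find p in inj₁ (l , inj₂ (l∈M , l∉L))
  ... | no p  | no q  = inj₂ (mk⇔ (λ l∈ → decidable-stable (_∈?_ σ _ M) (λ l∉ → p (lose l∈ l∉)))
                                  (λ l∈ → decidable-stable (_∈?_ σ _ L) (λ l∉ → q (lose l∈ l∉))))

  -- Every return to ggcp enlarges the span by a nonzero element that is
  -- irreducible modulo the old L.
  mutual

    acc-ggcp : ∀ {k G L₀} → DistinctLTs σ L₀ → codim σ L₀ < suc k → (∀ {f} → Span L₀ f → Span (Tuple.L G) f) →
               ∃[ r ] (r ∈ Tuple.L G × r ≢ 0ˡ × Clean σ (_∈ L₀) r) → Acc (flip (Step σ)) (ggcp G)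
    acc-ggcp {k} d₀ bound L₀⊆ (r , r∈ , r≢0 , clean) = acc λ { (interreduce ((_ , L⊆L₁) , d₁)) →
      -- The codimension of the new `L₁` is below that of `L₀`, which is at most `k`.
      acc-loop k d₁ (Pass-start σ)
        (ℕ.<-≤-trans (codim-< σ d₀ d₁ (L⊆L₁ ∘ L₀⊆) (L⊆L₁ (∈⇒Span r∈)) r≢0 clean) (s≤s⁻¹ bound)) }

    acc-loop : ∀ k {L done G′ es} → DistinctLTs σ L → Pass σ L done G′ → codim σ L < k →
               Acc (flip (Step σ)) (loop L es G′)
    acc-loop k {es = _ ∷ es} d pass bound = acc λ { (visit nf ng) →
      acc-loop k {es = es} d (Pass-visit σ pass nf ng (append-appended _ _ _)) bound }
    -- The strict bound rules out `zero`, and the unit taken off here pays for a possible return to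
    -- `ggcp`.
    acc-loop (suc k) {L} {G′ = G′} {es = []} d pass bound = acc λ
      { (repeat L≁L′) → acc-ggcp d bound (Span-least (∈⇒Span ∘ Pass.L⊆L′ pass)) (new L≁L′)
      ; (return _)     → acc-comps d pass bound }
      where
      new : ¬ L ∼[ set ] Tuple.L G′ → ∃[ r ] (r ∈ Tuple.L G′ × r ≢ 0ˡ × Clean σ (_∈ L) r)
      new L≁L′ with L ∼? Tuple.L G′
      ... | inj₂ L∼L′ = ⊥-elim (L≁L′ L∼L′)
      ... | inj₁ (_ , inj₁ (l∈L , l∉L′)) = ⊥-elim (l∉L′ (Pass.L⊆L′ pass l∈L))
      ... | inj₁ (l , inj₂ (l∈L′ , l∉L)) = l , l∈L′ , Pass-forced pass l∈L′ l∉L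

    acc-comps : ∀ {k L done G′} → DistinctLTs σ L → Pass σ L done G′ → codim σ L < suc k →
                Acc (flip (Step σ)) (comps G′)
    acc-comps {k} {L} {G′ = G′} d pass bound = acc λ
      { (odd _ _)    → acc λ ()
      ; (finish _ _ _) → acc λ ()
      ; (merge all _ sums≢[]) →
          acc-ggcp d bound (Span-least (∈⇒Span ∘ ∈-++⁺ˡ ∘ Pass.L⊆L′ pass)) (new all (nonempty sums≢[])) }
      where
      nonempty : ∀ {ls : List (𝕃 n)} → ls ≢ [] → ∃[ l ] l ∈ ls
      nonempty {[]}    ≢[] = ⊥-elim (≢[] refl)
      nonempty {l ∷ _} _   = l , here refl
      vertex-clean : ∀ {v} → v ∈ Tuple.V G′ → Clean σ (_∈ L) v
      vertex-clean {v} v∈ = Irreducible⇒Clean σ v (Pass-vertex-irreducible pass v∈)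
      new : ∀ {𝒞} → AreAllSCCs G′ 𝒞 → ∃[ l ] l ∈ concatMap starSums 𝒞 →
            ∃[ r ] (r ∈ Tuple.L G′ ++ concatMap starSums 𝒞 × r ≢ 0ˡ × Clean σ (_∈ L) r)
      new all (l , l∈) with f , g , f∈V , g∈V , _ , f≢g , refl ← Components.concat-starSums⁻ G′ all l∈ =
        l , ∈-++⁺ʳ (Tuple.L G′) l∈ , f≢g ∘ +ˡ≡0⇒≡ , Clean-+ σ f g (vertex-clean f∈V) (vertex-clean g∈V)

  acc-start : ∀ G → Acc (flip (Step σ)) (ggcp G)
  acc-start G = acc λ { (interreduce (_ , d)) → acc-loop _ d (Pass-start σ) (ℕ.n<1+n _) }

  -- Accessibility alone would also hold for runs that get stuck. Here every choice that a step
  -- leaves open is shown to be possible.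
  progress : ∀ c → IsResult c ⊎ (∃[ c′ ] Step σ c c′)
  progress (ggcp ⟪ L , V , E ⟫) = inj₂ (_ , interreduce (proj₂ (interreduction σ L)))
  progress (loop L ((f , g) ∷ es) G′) = inj₂ (_ , visit (proj₂ (NR-exists σ L f)) (proj₂ (NR-exists σ L g)))
  progress (loop L [] G′) with L ∼? Tuple.L G′
  ... | inj₂ L∼L′ = inj₂ (_ , return L∼L′)
  ... | inj₁ (_ , inj₁ (l∈L , l∉L′)) = inj₂ (_ , repeat λ L∼L′ → l∉L′ (Equivalence.to L∼L′ l∈L))
  ... | inj₁ (_ , inj₂ (l∈L′ , l∉L)) = inj₂ (_ , repeat λ L∼L′ → l∉L (Equivalence.from L∼L′ l∈L′))
  progress (comps G′) with 2 ∣? length (Components.SCCs G′)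
  ... | no ¬even = inj₂ (_ , odd (Components.SCCs-complete G′) ¬even)
  ... | yes even with concatMap starSums (Components.SCCs G′) in eq
  ...   | []    = inj₂ (_ , finish (Components.SCCs-complete G′) even eq)
  ...   | _ ∷ _ = inj₂ (_ , merge (Components.SCCs-complete G′) even λ eq′ → case trans (sym eq) eq′ of λ ())
  progress (result G′) = inj₁ (G′ , refl)

  generator⁻ : ∀ {f} → f ∈ 𝕃-generators n → ∃[ i ] f ≡ monomial i
  generator⁻ f∈ = ∈-tabulate⁻ f∈

  generators-distinct : DistinctLTs σ (𝕃-generators n)
  generators-distinct = nonzero , injective
    where
    nonzero : ∀ {f} → f ∈ 𝕃-generators n → f ≢ 0ˡ
    nonzero f∈ eq with i , refl ← generator⁻ f∈ =
      true≢false (monomial-≡ i) (trans (cong (λ f → lookup f i) eq) (lookup-0ˡ {n} i))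
    injective : ∀ {f g t} → f ∈ 𝕃-generators n → g ∈ 𝕃-generators n → IsLT σ f t → IsLT σ g t → f ≡ g
    injective f∈ g∈ lt lt′ with i , refl ← generator⁻ f∈ | j , refl ← generator⁻ g∈
      with k , refl , Lk ← IsLT⇒Lead σ {f = monomial i} lt | l , eq , Ll ← IsLT⇒Lead σ {f = monomial j} lt′
      with refl ← term-injective {i = l} {k} eq =
      cong monomial (trans (sym (monomial-true {i = i} (Lead.occurs Lk))) (monomial-true {i = j} (Lead.occurs Ll)))

  -- Every position is led by a generator, so reduction by the generators leaves nothing.
  generators-span : ∀ f → Span (𝕃-generators n) f
  generators-span f with r , steps , clean ← reduce σ (_∈ 𝕃-generators n) (leader? σ (𝕃-generators n)) f =
    subst (Span _) (trans (cong (f +ˡ_) r≡0) (+ˡ-identityʳ f)) (Reduction-Span σ steps)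
    where
    r≡0 : r ≡ 0ˡ
    r≡0 = lookup-ext λ i → trans (clean (∈-tabulate⁺ {f = monomial} i) (Lead-monomial σ i)) (sym (lookup-0ˡ {n} i))

  -- The invariant of a run.

  module _ {I : Pred (𝔹 n) 0ℓ} (G₀ : Tuple n) where

    Correct : Tuple n → Set
    Correct G = IsIGS I G × G ⪯ G₀

    -- The edges of the IGS that GGCP is processing are those visited so far,
    -- most recent first in done, followed by es.
    Invariant : Configuration n → Set
    Invariant (ggcp G)       = Correct G
    Invariant (loop L es G′) = ∃[ V ] ∃[ done ]
      (Correct ⟪ L , V , done ʳ++ es ⟫ × DistinctLTs σ L × Pass σ L done G′)
    -- The vertex set of an implication graph structure may have isolated vertices `v` without
    -- `v +ˡ 1ˡ`. After a complete pass all vertices are ends of edges, and the parity argument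
    -- relies on the resulting closure.
    Invariant (comps G′)     = Correct G′ × IsReduced σ G′ × (∀ {v} → v ∈ Tuple.V G′ → v +ˡ 1ˡ ∈ Tuple.V G′)
    Invariant (result G′)    = (IsIGS I G′ × IsReduced σ G′) × (G′ ⪯ G₀) × IsAcyclic G′

    preserved : ∀ {c c′} → Step σ c c′ → Invariant c → Invariant c′
    preserved (interreduce {V = V} (eq , d)) (igs , sp , card) =
      V , [] , (igs′ , proj₂ eq ∘ sp , card) , d , Pass-start σ
      where
      igs′ = IGS-replace-L igs
        (λ l∈L → Ideal.Span⇒ (𝒥-isIdeal _ _) 𝒥-gen (proj₂ eq (∈⇒Span l∈L)))
        (λ l∈L₁ → Ideal.Span⇒ (𝒥-isIdeal _ _) 𝒥-gen (proj₁ eq (∈⇒Span l∈L₁)))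
    -- `done ʳ++ (e ∷ es)` and `(e ∷ done) ʳ++ es` are equal by computation, so `correct` passes on
    -- unchanged.
    preserved (visit nf ng) (V , done , correct , d , pass) =
      V , _ ∷ done , correct , d , Pass-visit σ pass nf ng (append-appended _ _ _)
    -- With no edges left, `done ʳ++ []` is `reverse done`, whence `reverse⁺` and `reverse⁻`.
    preserved (repeat _) (V , done , (igs , sp , card) , d , pass) =
      P.isIGS , (proj₁ P.decreases ∘ sp , ℕ.≤-trans (proj₂ P.decreases) card)
      where module P = CompletePass igs d pass reverse⁺ reverse⁻
    preserved (return eq) (V , done , (igs , sp , card) , d , pass) =
      (P.isIGS , (proj₁ P.decreases ∘ sp , ℕ.≤-trans (proj₂ P.decreases) card)) , P.isReduced eq , P.vertex-+1
      where module P = CompletePass igs d pass reverse⁺ reverse⁻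
    preserved (odd {⟪ L , V , E ⟫} all ¬even) ((igs , sp , _) , red , V+1) =
      (igs′ , generators-distinct , λ _ ()) , ((λ _ → generators-span _) , z≤n) , no-cycle
      where
      K = 𝒥-isIdeal L E
      1∈ : 𝒥 L E 1ᵇ
      -- A cycle through `f` and `f +ˡ 1ˡ` puts their sum, which is `1ˡ`, into the ideal.
      1∈ with f , p , q ← Components.odd⇒f~f+1 _ all (skew-edge igs) V+1 ¬even =
        IsIdeal.resp K ι-1 (subst (𝒥 L E ∘ ι) (+ˡ-cancelˡ f 1ˡ) (𝒥-cycle p q))
      igs′ : IsIGS I ⟪ 𝕃-generators n , [] , [] ⟫
      igs′ = record
        { edges⊆V² = λ ()
        -- The first generator of `𝕃 n` is `1ˡ`, so both ideals are the whole ring.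
        ; ideal = (λ {p} _ → Ideal.1∈⇒all (𝒥-isIdeal _ _) (IsIdeal.resp (𝒥-isIdeal _ _) ι-1 (𝒥-gen (here refl))) p)
                , λ {p} _ → proj₂ (IsIGS.ideal igs) (Ideal.1∈⇒all K 1∈ p)
        ; skew-symmetric = λ ()
        ; irreflexive = λ () }
      no-cycle : IsAcyclic ⟪ 𝕃-generators n , [] , [] ⟫
      no-cycle _ = λ { [ () ] ; (() ∷ _) }
    preserved (merge {L} {V} {E} {𝒞} all _ _) ((igs , sp , card) , _ , _) =
      IGS-replace-L igs (𝒥-gen ∘ ∈-++⁺ˡ) sums∈ , Span-least (∈⇒Span ∘ ∈-++⁺ˡ) ∘ sp , card
      where
      sums∈ : ∀ {l} → l ∈ L ++ concatMap starSums 𝒞 → 𝒥 L E (ι l)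
      sums∈ l∈ with ∈-++⁻ L l∈
      ... | inj₁ l∈L = 𝒥-gen l∈L
      ... | inj₂ l∈S with f , g , _ , _ , (p , q) , _ , refl ← Components.concat-starSums⁻ _ all l∈S =
        𝒥-cycle p q
    preserved (finish all _ none) ((igs , dec) , red , _) =
      (igs , red) , dec , Components.starSums≡[]⇒acyclic _ all none edges
      where
      edges : ∀ {f g} → (f , g) ∈ _ → f ∈ _ × g ∈ _ × f ≢ g
      edges e∈ = let f∈ , g∈ = IsIGS.edges⊆V² igs e∈ in f∈ , g∈ , λ { refl → IsIGS.irreflexive igs f∈ e∈ }

    run-preserved : ∀ {c c′} → Steps σ c c′ → Invariant c → Invariant c′
    run-preserved ε        inv = inv
    run-preserved (s ◅ ss) inv = run-preserved ss (preserved s inv)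

proposition4p13 : (n : ℕ) (σ : TermOrdering n) (F : 2-XNF n) (I_F : Pred (𝔹 n) 0ℓ) → IsIdealOf F I_F →
    (G : Tuple n) → IsIGS I_F G →
    Acc (flip (Step σ)) (ggcp G) ×
    (∀ c → Steps σ (ggcp G) c → IsResult c ⊎ (∃[ c′ ] Step σ c c′)) ×
    (∀ G′ → Steps σ (ggcp G) (result G′) →
    (IsIGS I_F G′ × IsReduced σ G′) × (G′ ⪯ G) × IsAcyclic G′)
proposition4p13 n σ F I_F _ G igs =
  acc-start σ G , (λ c _ → progress σ c) , λ G′ run → run-preserved σ G run (igs , id , ℕ.≤-refl)
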